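{- Let $\mathcal M=(M,<,\ldots)$ be a definably complete locally o-minimal structure having property (a) (the image of a nonempty definable discrete set under a coordinate projection is again discrete). Let $X\subseteq M^m$ and $Y\subseteq M^n$ be definable sets and let $\varphi:X\to Y$ be a definable surjective map whose fibers are equi-dimensional, that is, the dimension of the fiber $\varphi^{ -1}(y)$ is the same for all $y\in Y$. Then $\dim X=\dim Y+\dim\varphi^{ -1}(y)$ for all $y\in Y$.
   Context: "Definable" means definable in $\mathcal M$ with parameters. $M$ carries the order topology and $M^n$ the product topology ($M^0$ is a single point). An open interval is a set $(a,b)=\{x\in M\mid a<x<b\}$ with $a,b\in M$. A coordinate projection $M^n\to M^d$ is a map $(x_1,\ldots,x_n)\mapsto(x_{i_1},\ldots,x_{i_d})$ with $1\le i_1<\cdots<i_d\le n$. A set is discrete if its subspace topology is discrete. A densely linearly ordered structure without endpoints $\mathcal M=(M,<,\ldots)$ is locally o-minimal if for every definable $X\subseteq M$ and every $a\in M$ there is an open interval $I$ containing $a$ such that $X\cap I$ is a finite union of points and open intervals. It is definably complete if every definable subset of $M$ has a supremum and an infimum in $M\cup\{\pm\infty\}$. Dimension: for a nonempty definable $X\subseteq M^n$, $\dim X$ is the maximal nonnegative integer $d$ such that $\pi(X)$ has a nonempty interior for some coordinate projection $\pi:M^n\to M^d$; $\dim\emptyset=-\infty$. -}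

module Defs where

open import Level using (Level; suc; Lift; lift)
open import Axiom.ExcludedMiddle using (ExcludedMiddle)
open import Data.Nat as ℕ using (ℕ; zero; z≤n; s≤s)
import Data.Nat.Properties as ℕ
open import Data.Fin as Fin using (Fin; toℕ)
import Data.Fin.Properties as Fin
open import Data.List using (List)
open import Data.List.Relation.Unary.Any using (Any)
open import Data.Vec using (Vec; []; _∷_; _++_; map; lookup; head; take; drop)
open import Data.Vec.Relation.Unary.All as All using (All; []; _∷_)
open import Data.Vec.Relation.Unary.AllPairs using (AllPairs; []; _∷_)
open import Data.Product using (∃; ∃-syntax; ∃!; _×_; _,_; proj₁; proj₂)
open import Data.Sum using (_⊎_; inj₁; inj₂)
open import Function.Base using (_∘_)
open import Function.Bundles using (_⇔_)
open import Relation.Binary.Core using (Rel)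
open import Relation.Binary.Definitions using (Dense)
open import Relation.Binary.Structures using (IsStrictTotalOrder)
open import Relation.Binary.PropositionalEquality using (_≡_; refl; cong; subst)
import Relation.Binary.Construct.StrictToNonStrict as StrictToNonStrict
import Relation.Binary.Construct.Add.Extrema.NonStrict as AddExtrema
open import Relation.Nullary using (¬_; yes; no; contradiction)
open import Relation.Nullary.Construct.Add.Extrema using (_±; [_])
open import Relation.Nullary.Construct.Add.Infimum using (_₋; ⊥₋) renaming ([_] to fin)
open import Relation.Unary using (Pred; _∈_; _⊆_; Satisfiable; Empty)

-- The symbols of the language other than < and =.
record Signature (ℓ : Level) : Set (suc ℓ) where
  field
    FunSym : ℕ → Set ℓ
    RelSym : ℕ → Set ℓ

module _ {ℓ : Level} (L : Signature ℓ) where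
  open Signature L

  -- Terms and formulas with free variables among n variables (de Bruijn
  -- indices; a quantifier binds index zero).
  data Term (n : ℕ) : Set ℓ where
    var : Fin n → Term n
    app : ∀ {k} → FunSym k → Vec (Term n) k → Term n

  data Formula (n : ℕ) : Set ℓ where
    _≐_ : Term n → Term n → Formula n
    _≺_ : Term n → Term n → Formula n
    rel : ∀ {k} → RelSym k → Vec (Term n) k → Formula n
    neg : Formula n → Formula n
    _∧_ : Formula n → Formula n → Formula n
    _∨_ : Formula n → Formula n → Formula n
    ex  : Formula (ℕ.suc n) → Formula n
    all : Formula (ℕ.suc n) → Formula n

  record Structure : Set (suc ℓ) where
    field
      Carrier            : Set ℓ
      element            : Carrier
      _<_                : Rel Carrier ℓ
      isStrictTotalOrder : IsStrictTotalOrder _≡_ _<_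
      dense              : Dense _<_
      no-least           : ∀ x → ∃[ y ] y < x
      no-greatest        : ∀ x → ∃[ y ] x < y
      ⟦_⟧ᶠ               : ∀ {k} → FunSym k → Vec Carrier k → Carrier
      ⟦_⟧ʳ               : ∀ {k} → RelSym k → Pred (Vec Carrier k) ℓ

module _ {ℓ : Level} {L : Signature ℓ} (𝓜 : Structure L) where
  open Structure 𝓜 renaming (Carrier to M)

  Point : ℕ → Set ℓ
  Point n = Vec M n

  Subset : ℕ → Set (suc ℓ)
  Subset n = Pred (Point n) ℓ

  mutual
    eval : ∀ {n} → Term L n → Point n → M
    eval (var i)    ρ = lookup ρ i
    eval (app f ts) ρ = ⟦ f ⟧ᶠ (evals ts ρ)

    evals : ∀ {n k} → Vec (Term L n) k → Point n → Point k
    evals []       ρ = []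
    evals (t ∷ ts) ρ = eval t ρ ∷ evals ts ρ

  ⟦_⟧ : ∀ {n} → Formula L n → Subset n
  ⟦ s ≐ t ⟧    ρ = eval s ρ ≡ eval t ρ
  ⟦ s ≺ t ⟧    ρ = eval s ρ < eval t ρ
  ⟦ rel R ts ⟧ ρ = ⟦ R ⟧ʳ (evals ts ρ)
  ⟦ neg φ ⟧    ρ = ¬ ⟦ φ ⟧ ρ
  ⟦ φ ∧ ψ ⟧    ρ = ⟦ φ ⟧ ρ × ⟦ ψ ⟧ ρ
  ⟦ φ ∨ ψ ⟧    ρ = ⟦ φ ⟧ ρ ⊎ ⟦ ψ ⟧ ρ
  ⟦ ex φ ⟧     ρ = ∃[ a ] ⟦ φ ⟧ (a ∷ ρ)
  ⟦ all φ ⟧    ρ = ∀ a → ⟦ φ ⟧ (a ∷ ρ)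

  -- Definability with parameters; the vector p lists the parameters.
  Definable : ∀ {n} → Subset n → Set ℓ
  Definable {n} X =
    ∃[ k ] ∃[ φ ] ∃[ p ] (∀ x → X x ⇔ ⟦_⟧ {n ℕ.+ k} φ (x ++ p))

  Definable₁ : Pred M ℓ → Set ℓ
  Definable₁ X = Definable {1} (X ∘ head)

  Interval : M → M → Pred M ℓ
  Interval a b x = a < x × x < b

  -- The open intervals with endpoints in M form a base of the order topology
  -- because the order has no endpoints.
  Open₁ : Pred M ℓ → Set ℓ
  Open₁ U = ∀ {x} → x ∈ U → ∃[ a ] ∃[ b ] (x ∈ Interval a b × Interval a b ⊆ U)

  Product : ∀ {n} → (Fin n → Pred M ℓ) → Subset n
  Product V x = ∀ i → lookup x i ∈ V i

  Open : ∀ {n} → Subset n → Set (suc ℓ)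
  Open {n} U = ∀ {x} → x ∈ U →
    ∃[ V ] ((∀ (i : Fin n) → Open₁ (V i)) × x ∈ Product V × Product V ⊆ U)

  Interior : ∀ {n} → Subset n → Pred (Point n) (suc ℓ)
  Interior X x = ∃[ U ] (Open U × x ∈ U × U ⊆ X)

  -- Every singleton is open in the subspace topology.
  Discrete : ∀ {n} → Subset n → Set (suc ℓ)
  Discrete X = ∀ {x} → x ∈ X →
    ∃[ U ] (Open U × x ∈ U × (∀ {y} → y ∈ X → y ∈ U → y ≡ x))

  record CoordinateProjection (n d : ℕ) : Set where
    field
      indices    : Vec (Fin n) d
      increasing : AllPairs Fin._<_ indices

  project : ∀ {n d} → CoordinateProjection n d → Point n → Point d
  project π x = map (lookup x) (CoordinateProjection.indices π)

  image : ∀ {n d} → CoordinateProjection n d → Subset n → Subset d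
  image π X y = ∃[ x ] (x ∈ X × project π x ≡ y)

  data Piece : Set ℓ where
    point    : M → Piece
    interval : M → M → Piece

  _∈ₚ_ : M → Piece → Set ℓ
  x ∈ₚ point a      = x ≡ a
  x ∈ₚ interval a b = x ∈ Interval a b

  LocallyOMinimal : Set (suc ℓ)
  LocallyOMinimal = ∀ (X : Pred M ℓ) → Definable₁ X → ∀ a →
    ∃[ b ] ∃[ c ] (a ∈ Interval b c ×
      ∃[ ps ] (∀ x → (x ∈ X × x ∈ Interval b c) ⇔ Any (x ∈ₚ_) ps))

  open StrictToNonStrict _≡_ _<_ using (_≤_)
  open AddExtrema _≤_ using (_≤±_)

  IsSupremum : Pred M ℓ → M ± → Set ℓ
  IsSupremum X s = (∀ {x} → x ∈ X → [ x ] ≤± s)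
                 × (∀ t → (∀ {x} → x ∈ X → [ x ] ≤± t) → s ≤± t)

  IsInfimum : Pred M ℓ → M ± → Set ℓ
  IsInfimum X s = (∀ {x} → x ∈ X → s ≤± [ x ])
                × (∀ t → (∀ {x} → x ∈ X → t ≤± [ x ]) → t ≤± s)

  DefinablyComplete : Set (suc ℓ)
  DefinablyComplete = ∀ (X : Pred M ℓ) → Definable₁ X →
    ∃ (IsSupremum X) × ∃ (IsInfimum X)

  PropertyA : Set (suc ℓ)
  PropertyA = ∀ {n d} (π : CoordinateProjection n d) (X : Subset n) →
    Definable X → Satisfiable X → Discrete X → Discrete (image π X)

  -- A map X → Y is given by its graph, a subset of Mᵐ⁺ⁿ.
  record DefinableMap {m n : ℕ} (X : Subset m) (Y : Subset n) : Set (suc ℓ) where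
    field
      graph      : Point m → Point n → Set ℓ
      definable  : Definable {m ℕ.+ n} (λ z → graph (take m z) (drop m z))
      domain     : ∀ {x y} → graph x y → x ∈ X
      codomain   : ∀ {x y} → graph x y → y ∈ Y
      functional : ∀ {x} → x ∈ X → ∃! _≡_ (graph x)

  module _ {m n : ℕ} {X : Subset m} {Y : Subset n} (φ : DefinableMap X Y) where
    open DefinableMap φ

    Surjective : Set ℓ
    Surjective = ∀ {y} → y ∈ Y → ∃[ x ] graph x y

    fiber : Point n → Subset m
    fiber y x = graph x y

  HasProjectionWithInterior : ∀ {n} → Subset n → ℕ → Set (suc ℓ)
  HasProjectionWithInterior {n} X d =
    ∃[ π ] Satisfiable (Interior (image {n} {d} π X))

  -- Dimensions live in ℕ ₋, i.e. ℕ ∪ {-∞}.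
  IsDim : ∀ {n} → Subset n → ℕ ₋ → Set (suc ℓ)
  IsDim X ⊥₋      = Lift (suc ℓ) (Empty X)
  IsDim X (fin d) = Satisfiable X × HasProjectionWithInterior X d
                  × (∀ e → HasProjectionWithInterior X e → e ℕ.≤ d)

  projection-≤ : ∀ {n d} → CoordinateProjection n d → d ℕ.≤ n
  projection-≤ {n} {d} π =
    subst (ℕ._≤ n) (ℕ.+-identityʳ d)
      (bound (CoordinateProjection.indices π) (CoordinateProjection.increasing π)
        (All.universal (λ _ → z≤n) _) z≤n)
    where
    bound : ∀ {e k} (is : Vec (Fin n) e) → AllPairs Fin._<_ is →
            All (λ i → k ℕ.≤ toℕ i) is → k ℕ.≤ n → e ℕ.+ k ℕ.≤ n
    bound []       []          []          k≤n = k≤n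
    bound {ℕ.suc e} {k} (i ∷ is) (i<is ∷ inc) (k≤i ∷ _) _ = ℕ.≤-trans
      (subst (ℕ._≤ e ℕ.+ ℕ.suc (toℕ i)) (ℕ.+-suc e k) (ℕ.+-monoʳ-≤ e (s≤s k≤i)))
      (bound is inc i<is (Fin.toℕ<n i))

  zero-projection : ∀ {n} (X : Subset n) → Satisfiable X → HasProjectionWithInterior X 0
  zero-projection {n} X (x , x∈X) =
    record { indices = [] ; increasing = [] } , [] ,
    image π₀ X , (λ { {[]} y∈ → (λ ()) , (λ ()) , (λ ()) , λ { {[]} _ → y∈ } }) ,
    (x , x∈X , refl) , λ y∈ → y∈
    where
    π₀ : CoordinateProjection n 0
    π₀ = record { indices = [] ; increasing = [] }

  -- Deciding which d has a projection with interior is not constructive, so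
  -- dim as a function depends on excluded middle.
  module _ (em : ∀ {a} → ExcludedMiddle a) where

    dim-exists : ∀ {n} (X : Subset n) → ∃ (IsDim X)
    dim-exists {n} X with em {P = Satisfiable X}
    ... | no  X-empty = ⊥₋ , lift (λ x x∈X → X-empty (x , x∈X))
    ... | yes X-sat   = search n (λ e h → projection-≤ (proj₁ h))
      where
      search : ∀ k → (∀ e → HasProjectionWithInterior X e → e ℕ.≤ k) → ∃ (IsDim X)
      search zero      bound = fin 0 , X-sat , zero-projection X X-sat , bound
      search (ℕ.suc k) bound with em {P = HasProjectionWithInterior X (ℕ.suc k)}
      ... | yes h = fin (ℕ.suc k) , X-sat , h , bound
      ... | no ¬h = search k λ e h →
        ℕ.≤-pred (ℕ.≤∧≢⇒< (bound e h) λ e≡ → ¬h (subst (HasProjectionWithInterior X) e≡ h))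

    dim : ∀ {n} → Subset n → ℕ ₋
    dim X = proj₁ (dim-exists X)

    dim-isDim : ∀ {n} (X : Subset n) → IsDim X (dim X)
    dim-isDim X = proj₂ (dim-exists X)

  IsDim-unique : ∀ {n} (X : Subset n) {d e} → IsDim X d → IsDim X e → d ≡ e
  IsDim-unique X {⊥₋}    {⊥₋}    _ _ = refl
  IsDim-unique X {⊥₋}    {fin _} (lift ∅) ((x , x∈X) , _) = contradiction x∈X (∅ x)
  IsDim-unique X {fin _} {⊥₋}    ((x , x∈X) , _) (lift ∅) = contradiction x∈X (∅ x)
  IsDim-unique X {fin d} {fin e} (_ , hd , maxd) (_ , he , maxe) =
    cong fin (ℕ.≤-antisym (maxe d hd) (maxd e he))

infixl 6 _+₋_

_+₋_ : ℕ ₋ → ℕ ₋ → ℕ ₋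
⊥₋    +₋ _     = ⊥₋
fin _ +₋ ⊥₋    = ⊥₋
fin d +₋ fin e = fin (d ℕ.+ e)

{-# OPTIONS --safe #-}
module Submission where

-- Call a definable subset of M large if it contains an interval. Local
-- o-minimality makes the sets that are not large discrete and closed under
-- finite unions. For a string s of quantifiers "there is x" and "there is an
-- interval of x", one for each coordinate, Big s P says that P holds under s,
-- and the number of interval quantifiers in s is then a rank of P. Additivity over
-- a coordinate projection is immediate for ranks, because a string for M^(m+n)
-- is a concatenation. So it is enough to show that ranks do not depend on the
-- order of the coordinates and that they give the dimension.
--
-- The order of two coordinates is exchanged by two facts about T ⊆ M². If the
-- first projection of T is large, then its second projection is large or a fiber
-- over a point of it is: otherwise T is discrete, and property (a) makes the first
-- projection discrete. If there is an interval of x with large fibers Tₓ, then T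
-- contains a box. This rests on exists-large-fiber, a substitute for the
-- monotonicity theorem: just above a point a, the points x that are the first
-- above a in some fiber T^y fill an interval.

open import Level using (Level; lift)
open import Axiom.ExcludedMiddle using (ExcludedMiddle)
open import Data.Bool using (Bool; true; false)
open import Data.Empty using (⊥; ⊥-elim)
open import Data.Nat as ℕ using (ℕ; zero; suc; _+_)
import Data.Nat.Properties as ℕ
open import Data.Fin as Fin using (Fin; zero; suc; _↑ˡ_; _↑ʳ_)
open import Data.Fin.Subset using (∣_∣)
open import Data.Fin.Subset.Properties using (∣⊥∣≡0; ∣⊤∣≡n)
open import Data.List using (List; []; _∷_)
open import Data.List.Relation.Unary.Any using (Any; here; there)
open import Data.Vec using (Vec; []; _∷_; _++_; head; tail; lookup; map; allFin; splitAt; replicate; take; drop)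
open import Data.Vec.Relation.Unary.AllPairs as AllPairs using (AllPairs; []; _∷_)
import Data.Vec.Relation.Unary.AllPairs.Properties as AllPairs
open import Data.Vec.Relation.Unary.All as All using ([]; _∷_)
import Data.Vec.Relation.Unary.All.Properties as All
open import Data.Vec.Properties
open import Data.Product using (∃; ∃-syntax; _×_; _,_; proj₁; proj₂; map₂)
open import Data.Sum as Sum using (_⊎_; inj₁; inj₂; [_,_]′)
open import Function.Base using (_∘_; id; case_of_)
open import Function.Bundles using (_⇔_; mk⇔; Equivalence)
open import Relation.Binary.Definitions using (tri<; tri≈; tri>)
open import Relation.Binary.Structures using (IsStrictTotalOrder)
open import Relation.Binary.PropositionalEquality using (_≡_; refl; sym; trans; cong; cong₂; subst; subst₂)
import Relation.Binary.Construct.StrictToNonStrict as StrictToNonStrict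
import Relation.Binary.Construct.Add.Extrema.NonStrict as AddExtrema
import Relation.Binary.Construct.Add.Supremum.NonStrict as AddSupremum
open import Relation.Nullary using (¬_; yes; no; contradiction)
open import Relation.Nullary.Construct.Add.Extrema using (⊥±; ⊤±; [_])
open import Relation.Nullary.Construct.Add.Infimum using (⊥₋) renaming ([_] to fin)
open import Relation.Nullary.Decidable using (decidable-stable)
open import Relation.Unary using (Pred; _∈_)
open import Defs

open Equivalence using (to; from)

-- Renaming the variables of a formula

module _ {ℓ : Level} {L : Signature ℓ} where

  mutual
    renameTerm : ∀ {m n} → (Fin m → Fin n) → Term L m → Term L n
    renameTerm r (var i)    = var (r i)
    renameTerm r (app f ts) = app f (renameTerms r ts)

    renameTerms : ∀ {m n k} → (Fin m → Fin n) → Vec (Term L m) k → Vec (Term L n) k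
    renameTerms r []       = []
    renameTerms r (t ∷ ts) = renameTerm r t ∷ renameTerms r ts

  rename : ∀ {m n} → (Fin m → Fin n) → Formula L m → Formula L n
  rename r (s ≐ t)    = renameTerm r s ≐ renameTerm r t
  rename r (s ≺ t)    = renameTerm r s ≺ renameTerm r t
  rename r (rel R ts) = rel R (renameTerms r ts)
  rename r (neg φ)    = neg (rename r φ)
  rename r (φ ∧ ψ)    = rename r φ ∧ rename r ψ
  rename r (φ ∨ ψ)    = rename r φ ∨ rename r ψ
  rename r (ex φ)     = ex (rename (Fin.lift 1 r) φ)
  rename r (all φ)    = all (rename (Fin.lift 1 r) φ)

  module _ (𝓜 : Structure L) where
    open Structure 𝓜 using () renaming (Carrier to M)

    Agree : ∀ {m n} → (Fin m → Fin n) → Vec M n → Vec M m → Set ℓ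
    Agree r ρ σ = ∀ i → lookup ρ (r i) ≡ lookup σ i

    mutual
      eval-rename : ∀ {m n} {r : Fin m → Fin n} {ρ σ} → Agree r ρ σ →
                    ∀ t → eval 𝓜 (renameTerm r t) ρ ≡ eval 𝓜 t σ
      eval-rename h (var i)    = h i
      eval-rename h (app f ts) = cong (Structure.⟦_⟧ᶠ 𝓜 f) (evals-rename h ts)

      evals-rename : ∀ {m n k} {r : Fin m → Fin n} {ρ σ} → Agree r ρ σ →
                     ∀ (ts : Vec (Term L m) k) → evals 𝓜 (renameTerms r ts) ρ ≡ evals 𝓜 ts σ
      evals-rename h []       = refl
      evals-rename h (t ∷ ts) = cong₂ _∷_ (eval-rename h t) (evals-rename h ts)

    agree-lift : ∀ {m n} {r : Fin m → Fin n} {ρ σ} → Agree r ρ σ →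
                 ∀ a → Agree (Fin.lift 1 r) (a ∷ ρ) (a ∷ σ)
    agree-lift h a zero    = refl
    agree-lift h a (suc i) = h i

    mutual
      -- Proved together with the converse `rename-from`, because negation exchanges the two
      -- directions.
      rename-to : ∀ {m n} {r : Fin m → Fin n} {ρ σ} → Agree r ρ σ →
                  ∀ φ → ⟦_⟧ 𝓜 (rename r φ) ρ → ⟦_⟧ 𝓜 φ σ
      rename-to h (s ≐ t)    = subst₂ _≡_ (eval-rename h s) (eval-rename h t)
      rename-to h (s ≺ t)    = subst₂ (Structure._<_ 𝓜) (eval-rename h s) (eval-rename h t)
      rename-to h (rel R ts) = subst (Structure.⟦_⟧ʳ 𝓜 R) (evals-rename h ts)
      rename-to h (neg φ)    = _∘ rename-from h φ
      rename-to h (φ ∧ ψ)    = λ (p , q) → rename-to h φ p , rename-to h ψ q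
      rename-to h (φ ∨ ψ)    = Sum.map (rename-to h φ) (rename-to h ψ)
      rename-to h (ex φ)     = λ (a , p) → a , rename-to (agree-lift h a) φ p
      rename-to h (all φ)    = λ p a → rename-to (agree-lift h a) φ (p a)

      rename-from : ∀ {m n} {r : Fin m → Fin n} {ρ σ} → Agree r ρ σ →
                    ∀ φ → ⟦_⟧ 𝓜 φ σ → ⟦_⟧ 𝓜 (rename r φ) ρ
      rename-from h (s ≐ t)    = subst₂ _≡_ (sym (eval-rename h s)) (sym (eval-rename h t))
      rename-from h (s ≺ t)    =
        subst₂ (Structure._<_ 𝓜) (sym (eval-rename h s)) (sym (eval-rename h t))
      rename-from h (rel R ts) = subst (Structure.⟦_⟧ʳ 𝓜 R) (sym (evals-rename h ts))
      rename-from h (neg φ)    = _∘ rename-to h φ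
      rename-from h (φ ∧ ψ)    = λ (p , q) → rename-from h φ p , rename-from h ψ q
      rename-from h (φ ∨ ψ)    = Sum.map (rename-from h φ) (rename-from h ψ)
      rename-from h (ex φ)     = λ (a , p) → a , rename-from (agree-lift h a) φ p
      rename-from h (all φ)    = λ p a → rename-from (agree-lift h a) φ (p a)

-- Definable sets

module Structures
  (em : ∀ {a} → ExcludedMiddle a) {ℓ : Level} {L : Signature ℓ} (𝓜 : Structure L)
  (complete : DefinablyComplete 𝓜) (local : LocallyOMinimal 𝓜) (propertyA : PropertyA 𝓜)
  where
  open Structure 𝓜 renaming (Carrier to M)
  open IsStrictTotalOrder isStrictTotalOrder using (compare; irrefl) renaming (trans to <-trans)

  record DefSet (n : ℕ) : Set (Level.suc ℓ) where
    infix 4 _∋_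
    field
      _∋_       : Vec M n → Set ℓ
      definable : Definable 𝓜 _∋_
  open DefSet

  definable-resp : ∀ {n} {X Y : Vec M n → Set ℓ} → (∀ ρ → X ρ ⇔ Y ρ) → Definable 𝓜 X → Definable 𝓜 Y
  definable-resp h (k , φ , p , d) =
    k , φ , p , λ ρ → mk⇔ (to (d ρ) ∘ from (h ρ)) (to (h ρ) ∘ from (d ρ))

  -- A coordinate of a map Mⁿ → Mᵏ that is either an input coordinate or a parameter.
  data Arg (n : ℕ) : Set ℓ where
    coord : Fin n → Arg n
    const : M → Arg n

  pattern x₀ = coord zero
  pattern x₁ = coord (suc zero)
  pattern x₂ = coord (suc (suc zero))
  pattern x₃ = coord (suc (suc (suc zero)))
  pattern x₄ = coord (suc (suc (suc (suc zero))))

  value : ∀ {n} → Vec M n → Arg n → M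
  value ρ (coord i) = lookup ρ i
  value ρ (const a) = a

  Coordinatewise : ∀ {n k} → (Vec M n → Vec M k) → Set ℓ
  Coordinatewise f = ∃[ ts ] ∀ ρ → map (value ρ) ts ≡ f ρ

  module _ {n k : ℕ} {X : Vec M k → Set ℓ} (ts : Vec (Arg n) k) where

    private
      constant : Arg n → M
      -- Every argument gets a parameter slot, whether it needs one or not. The slot of a coordinate
      -- is filled with `element`, and `place` never refers to it.
      constant (coord _) = element
      constant (const a) = a

      place : ∀ l → Arg n → Fin k → Fin (n + (k + l))
      place l (coord i) _ = i ↑ˡ (k + l)
      place l (const _) j = n ↑ʳ (j ↑ˡ l)

      reindex : ∀ l → Fin (k + l) → Fin (n + (k + l))
      reindex l = [ (λ j → place l (lookup ts j) j) , (λ j → n ↑ʳ (k ↑ʳ j)) ]′ ∘ Fin.splitAt k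

      agree : ∀ {l} (p : Vec M l) ρ →
              Agree 𝓜 (reindex l) (ρ ++ (map constant ts ++ p)) (map (value ρ) ts ++ p)
      agree p ρ i rewrite lookup-splitAt k (map (value ρ) ts) p i with Fin.splitAt k i
      ... | inj₂ j = trans (lookup-++ʳ ρ _ (k ↑ʳ j)) (lookup-++ʳ (map constant ts) p j)
      ... | inj₁ j rewrite lookup-map j (value ρ) ts with lookup ts j in eq
      ...   | coord i′ = lookup-++ˡ ρ _ i′
      ...   | const a  = trans (lookup-++ʳ ρ _ (j ↑ˡ _))
        (trans (lookup-++ˡ (map constant ts) p j)
          (trans (lookup-map j constant ts) (cong constant eq)))

    abstract
      -- An element of M is not a term of the language, so the constants among `ts` become k new
      -- parameters in front of the old ones, and the formula is only renamed.
      definable-substitute : Definable 𝓜 X → Definable 𝓜 (λ ρ → X (map (value ρ) ts))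
      definable-substitute (l , φ , p , d) =
        k + l , rename (reindex l) φ , map constant ts ++ p , λ ρ → mk⇔
          (rename-from 𝓜 (agree p ρ) φ ∘ to (d _))
          (from (d _) ∘ rename-to 𝓜 (agree p ρ) φ)

  abstract
    definable-pullback : ∀ {n k} (A : DefSet k) (f : Vec M n → Vec M k) → Coordinatewise f →
                         Definable 𝓜 (λ ρ → A ∋ f ρ)
    definable-pullback A f (ts , h) =
      definable-resp (λ ρ → mk⇔ (subst (A ∋_) (h ρ)) (subst (A ∋_) (sym (h ρ))))
                     (definable-substitute ts (definable A))

  pullback : ∀ {n k} → DefSet k → (f : Vec M n → Vec M k) → Coordinatewise f → DefSet n
  pullback A f c = record { definable = definable-pullback A f c }

  infixl 8 _⟨_⟩
  _⟨_⟩ : ∀ {n k} → DefSet k → Vec (Arg n) k → DefSet n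
  A ⟨ ts ⟩ = pullback A (λ ρ → map (value ρ) ts) (ts , λ _ → refl)

  infix 7 _≺ₐ_ _≐ₐ_
  _≺ₐ_ _≐ₐ_ : ∀ {n} → Arg n → Arg n → DefSet n
  s ≺ₐ t = record
    { _∋_ = λ ρ → value ρ s < value ρ t
    ; definable = definable-substitute {X = λ ρ → lookup ρ zero < lookup ρ (suc zero)} (s ∷ t ∷ [])
        (0 , var zero ≺ var (suc zero) , [] , λ { (_ ∷ _ ∷ []) → mk⇔ id id })
    }
  s ≐ₐ t = record
    { _∋_ = λ ρ → value ρ s ≡ value ρ t
    ; definable = definable-substitute {X = λ ρ → lookup ρ zero ≡ lookup ρ (suc zero)} (s ∷ t ∷ [])
        (0 , var zero ≐ var (suc zero) , [] , λ { (_ ∷ _ ∷ []) → mk⇔ id id })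
    }

  module _ {n : ℕ} where

    abstract
      definable-¬ : (A : DefSet n) → Definable 𝓜 (λ ρ → ¬ A ∋ ρ)
      definable-¬ A = let k , φ , p , d = definable A in
        k , neg φ , p , λ ρ → mk⇔ (_∘ from (d ρ)) (_∘ to (d ρ))

    complement : DefSet n → DefSet n
    complement A = record { definable = definable-¬ A }

    private
      left : ∀ k l → Fin (n + k) → Fin (n + (k + l))
      left k l = [ _↑ˡ (k + l) , (λ j → n ↑ʳ (j ↑ˡ l)) ]′ ∘ Fin.splitAt n

      right : ∀ k l → Fin (n + l) → Fin (n + (k + l))
      right k l = [ _↑ˡ (k + l) , (λ j → n ↑ʳ (k ↑ʳ j)) ]′ ∘ Fin.splitAt n

      agree-left : ∀ {k l} (p : Vec M k) (q : Vec M l) ρ → Agree 𝓜 (left k l) (ρ ++ (p ++ q)) (ρ ++ p)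
      agree-left p q ρ i rewrite lookup-splitAt n ρ p i with Fin.splitAt n i
      ... | inj₁ j = lookup-++ˡ ρ _ j
      ... | inj₂ j = trans (lookup-++ʳ ρ _ (j ↑ˡ _)) (lookup-++ˡ p q j)

      agree-right : ∀ {k l} (p : Vec M k) (q : Vec M l) ρ → Agree 𝓜 (right k l) (ρ ++ (p ++ q)) (ρ ++ q)
      agree-right p q ρ i rewrite lookup-splitAt n ρ q i with Fin.splitAt n i
      ... | inj₁ j = lookup-++ˡ ρ _ j
      ... | inj₂ j = trans (lookup-++ʳ ρ _ (_ ↑ʳ j)) (lookup-++ʳ p q j)

    abstract
      definable-× : (A B : DefSet n) → Definable 𝓜 (λ ρ → A ∋ ρ × B ∋ ρ)
      definable-× A B =
        let k , φ , p , d = definable A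
            l , ψ , q , e = definable B
        in k + l , rename (left k l) φ ∧ rename (right k l) ψ , p ++ q , λ ρ → mk⇔
          (λ (a , b) → rename-from 𝓜 (agree-left p q ρ) φ (to (d ρ) a)
                     , rename-from 𝓜 (agree-right p q ρ) ψ (to (e ρ) b))
          (λ (a , b) → from (d ρ) (rename-to 𝓜 (agree-left p q ρ) φ a)
                     , from (e ρ) (rename-to 𝓜 (agree-right p q ρ) ψ b))

    infixr 6 _⋀_
    _⋀_ : DefSet n → DefSet n → DefSet n
    A ⋀ B = record { definable = definable-× A B }

    abstract
      definable-→ : (A B : DefSet n) → Definable 𝓜 (λ ρ → A ∋ ρ → B ∋ ρ)
      definable-→ A B = definable-resp
        (λ ρ → mk⇔ (λ h a → decidable-stable em (λ ¬b → h (a , ¬b))) (λ h (a , ¬b) → ¬b (h a)))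
        (definable (complement (A ⋀ complement B)))

    infixr 5 _⇒_
    _⇒_ : DefSet n → DefSet n → DefSet n
    A ⇒ B = record { definable = definable-→ A B }

    abstract
      definable-⊎ : (A B : DefSet n) → Definable 𝓜 (λ ρ → A ∋ ρ ⊎ B ∋ ρ)
      definable-⊎ A B = definable-resp
        (λ ρ → mk⇔ (classical ρ) λ { (inj₁ a) (¬a , _) → ¬a a ; (inj₂ b) (_ , ¬b) → ¬b b })
        (definable (complement (complement A ⋀ complement B)))
        where
        classical : ∀ ρ → ¬ ((¬ A ∋ ρ) × (¬ B ∋ ρ)) → A ∋ ρ ⊎ B ∋ ρ
        classical ρ h with em {P = A ∋ ρ} | em {P = B ∋ ρ}
        ... | yes a | _     = inj₁ a
        ... | no _  | yes b = inj₂ b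
        ... | no ¬a | no ¬b = contradiction (¬a , ¬b) h

    infixr 5 _⋁_
    _⋁_ : DefSet n → DefSet n → DefSet n
    A ⋁ B = record { definable = definable-⊎ A B }

    abstract
      -- The condition P does not depend on the point, so by excluded middle the set is either A or
      -- empty.
      definable-guard : (P : Set) (A : DefSet n) → Definable 𝓜 (λ ρ → P × A ∋ ρ)
      definable-guard P A with em {P = P}
      ... | yes p = definable-resp (λ ρ → mk⇔ (p ,_) proj₂) (definable A)
      ... | no ¬p = definable-resp
        (λ ρ → mk⇔ (λ (a , ¬a) → contradiction a ¬a) (λ (p , _) → contradiction p ¬p))
        (definable (A ⋀ complement A))

    guard : Set → DefSet n → DefSet n
    guard P A = record { definable = definable-guard P A }

    abstract
      definable-∃ : (A : DefSet (suc n)) → Definable 𝓜 (λ ρ → ∃[ x ] A ∋ (x ∷ ρ))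
      definable-∃ A = let k , φ , p , d = definable A in
        k , ex φ , p , λ ρ → mk⇔ (map₂ (to (d _))) (map₂ (from (d _)))

      definable-∀ : (A : DefSet (suc n)) → Definable 𝓜 (λ ρ → ∀ x → A ∋ (x ∷ ρ))
      definable-∀ A = let k , φ , p , d = definable A in
        k , all φ , p , λ ρ → mk⇔ (λ h x → to (d _) (h x)) (λ h x → from (d _) (h x))

    some every : DefSet (suc n) → DefSet n
    some  A = record { definable = definable-∃ A }
    every A = record { definable = definable-∀ A }

  value-coords : ∀ {n} (ρ : Vec M n) → map (value ρ) (map coord (allFin n)) ≡ ρ
  value-coords ρ = trans (sym (map-∘ (value ρ) coord _)) (map-lookup-allFin ρ)

  value-consts : ∀ {n k} (ρ : Vec M n) (σ : Vec M k) → map (value ρ) (map const σ) ≡ σ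
  value-consts ρ σ = trans (sym (map-∘ (value ρ) const σ)) (map-id σ)

  slice : ∀ {j n} → DefSet (j + n) → Vec M n → DefSet j
  slice A ρ = pullback A (_++ ρ)
    ( map coord (allFin _) ++ map const ρ
    , λ σ → trans (map-++ (value σ) (map coord (allFin _)) (map const ρ))
                  (cong₂ _++_ (value-coords σ) (value-consts σ ρ)))

  -- Makes room for the two endpoints of an interval, which are bound between x and the remaining
  -- coordinates.
  insert₂ : ∀ {n} → DefSet (suc n) → DefSet (suc (suc (suc n)))
  insert₂ A = pullback A (λ σ → head σ ∷ tail (tail (tail σ)))
    ( x₀ ∷ map (λ i → coord (suc (suc (suc i)))) (allFin _)
    , λ { (x ∷ b ∷ a ∷ σ) → cong (x ∷_)
          (trans (sym (map-∘ (value (x ∷ b ∷ a ∷ σ)) _ (allFin _))) (map-lookup-allFin σ)) })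

  -- Intervals and discreteness on the line

  HasInterval : Pred M ℓ → Set ℓ
  HasInterval P = ∃[ a ] ∃[ b ] (a < b × (∀ x → a < x → x < b → P x))

  abstract
    definable-HasInterval : ∀ {n} (A : DefSet (suc n)) →
                            Definable 𝓜 (λ ρ → HasInterval (λ x → A ∋ (x ∷ ρ)))
    definable-HasInterval A =
      definable (some (some (x₁ ≺ₐ x₀ ⋀ every (x₂ ≺ₐ x₀ ⇒ x₀ ≺ₐ x₁ ⇒ insert₂ A))))
  large : ∀ {n} → DefSet (suc n) → DefSet n
  large A = record { definable = definable-HasInterval A }

  ≮-<-trans : ∀ {x y z} → ¬ y < x → y < z → x < z
  ≮-<-trans {x} {y} y≮x y<z with compare x y
  ... | tri< x<y _ _    = <-trans x<y y<z
  ... | tri≈ _ refl _   = y<z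
  ... | tri> _ _ y<x    = contradiction y<x y≮x

  <-≮-trans : ∀ {x y z} → x < y → ¬ z < y → x < z
  <-≮-trans {x} {y} {z} x<y z≮y with compare y z
  ... | tri< y<z _ _    = <-trans x<y y<z
  ... | tri≈ _ refl _   = x<y
  ... | tri> _ _ z<y    = contradiction z<y z≮y

  ≮-cases : ∀ {a} {R : Set a} x y → (¬ y < x → R) → (¬ x < y → R) → R
  ≮-cases x y f g with compare x y
  ... | tri< _ _ y≮x = f y≮x
  ... | tri≈ _ _ y≮x = f y≮x
  ... | tri> x≮y _ _ = g x≮y

  <-irrefl : ∀ {x} → ¬ x < x
  <-irrefl = irrefl refl

  <-asym : ∀ {x y} → x < y → ¬ y < x
  <-asym x<y y<x = <-irrefl (<-trans x<y y<x)

  meet : ∀ {x e e′} → x < e → x < e′ → ∃[ d ] (x < d × (∀ {z} → z < d → z < e × z < e′))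
  meet {x} {e} {e′} x<e x<e′ with compare e e′
  ... | tri< e<e′ _ _   = e , x<e , λ z<e → z<e , <-trans z<e e<e′
  ... | tri≈ _ refl _   = e , x<e , λ z<e → z<e , z<e
  ... | tri> _ _ e′<e   = e′ , x<e′ , λ z<e′ → <-trans z<e′ e′<e , z<e′

  join : ∀ {x e e′} → e < x → e′ < x → ∃[ d ] (d < x × (∀ {z} → d < z → e < z × e′ < z))
  join {x} {e} {e′} e<x e′<x with compare e e′
  ... | tri< e<e′ _ _   = e′ , e′<x , λ e′<z → <-trans e<e′ e′<z , e′<z
  ... | tri≈ _ refl _   = e , e<x , λ e<z → e<z , e<z
  ... | tri> _ _ e′<e   = e , e<x , λ e<z → e<z , <-trans e′<e e<z

  HasInterval-map : ∀ {P Q : Pred M ℓ} → (∀ x → P x → Q x) → HasInterval P → HasInterval Q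
  HasInterval-map f (a , b , a<b , h) = a , b , a<b , λ x a<x x<b → f x (h x a<x x<b)

  HasInterval-nonempty : ∀ {P : Pred M ℓ} → HasInterval P → ∃ P
  HasInterval-nonempty (a , b , a<b , h) = let x , a<x , x<b = dense a<b in x , h x a<x x<b

  Germ : Pred M ℓ → M → Set ℓ
  Germ P a = ∃[ e ] (a < e × ((∀ x → a < x → x < e → P x) ⊎ (∀ x → a < x → x < e → ¬ P x)))

  pieces-germ : ∀ a ps → Germ (λ x → Any (_∈ₚ_ 𝓜 x) ps) a
  pieces-germ a [] = let e , a<e = no-greatest a in e , a<e , inj₂ λ _ _ _ ()
  pieces-germ a (p ∷ ps) with pieces-germ a ps | piece p
    where
    piece : ∀ p → Germ (λ x → _∈ₚ_ 𝓜 x p) a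
    piece (point u) with compare a u
    ... | tri< a<u _ _  = u , a<u , inj₂ λ { _ _ x<x refl → <-irrefl x<x }
    ... | tri≈ _ refl _ = let e , a<e = no-greatest a in e , a<e , inj₂ λ { _ x<x _ refl → <-irrefl x<x }
    ... | tri> _ _ u<a  = let e , a<e = no-greatest a in e , a<e , inj₂ λ { _ a<x _ refl → <-asym u<a a<x }
    piece (interval u v) with compare a u | compare a v
    ... | tri< a<u _ _  | _             = u , a<u , inj₂ λ _ _ x<u (u<x , _) → <-asym x<u u<x
    ... | tri≈ _ refl _ | tri< a<v _ _  = v , a<v , inj₁ λ _ a<x x<v → a<x , x<v
    ... | tri> _ _ u<a  | tri< a<v _ _  = v , a<v , inj₁ λ _ a<x x<v → <-trans u<a a<x , x<v
    ... | _             | tri≈ _ refl _ =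
      let e , a<e = no-greatest a in e , a<e , inj₂ λ _ a<x _ (_ , x<a) → <-asym a<x x<a
    ... | _             | tri> _ _ v<a  =
      let e , a<e = no-greatest a in e , a<e , inj₂ λ _ a<x _ (_ , x<v) → <-asym v<a (<-trans a<x x<v)
  ... | e , a<e , inj₁ in-ps | _ = e , a<e , inj₁ λ x a<x x<e → there (in-ps x a<x x<e)
  ... | _ | e , a<e , inj₁ in-p = e , a<e , inj₁ λ x a<x x<e → here (in-p x a<x x<e)
  ... | e , a<e , inj₂ not-ps | e′ , a<e′ , inj₂ not-p =
    let d , a<d , below = meet a<e a<e′ in d , a<d , inj₂ λ where
      x a<x x<d (here x∈p)   → not-p x a<x (proj₂ (below x<d)) x∈p
      x a<x x<d (there x∈ps) → not-ps x a<x (proj₁ (below x<d)) x∈ps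

  definable₁ : (A : DefSet 1) → Definable₁ 𝓜 (λ x → A ∋ (x ∷ []))
  definable₁ A = definable-resp (λ { (x ∷ []) → mk⇔ id id }) (definable A)

  -- Near a the set is a finite union of points and intervals, and each of these either fills or
  -- misses a short interval to the right of a.
  germ : (A : DefSet 1) → ∀ a → Germ (λ x → A ∋ (x ∷ [])) a
  germ A a with local _ (definable₁ A) a
  ... | b , c , (b<a , a<c) , ps , h with pieces-germ a ps
  ... | e , a<e , side = let d , a<d , below = meet a<e a<c in d , a<d ,
    Sum.map
      (λ in-ps x a<x x<d → proj₁ (from (h x) (in-ps x a<x (proj₁ (below x<d)))))
      (λ not-ps x a<x x<d x∈A → not-ps x a<x (proj₁ (below x<d))
        (to (h x) (x∈A , <-trans b<a a<x , proj₂ (below x<d))))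
      side

  -- Consider the germ of A at the left end of the interval: if A does not fill a short interval
  -- there, it misses one, and B has to fill it.
  HasInterval-⊎ : (A B : DefSet 1) → HasInterval (λ x → A ∋ (x ∷ []) ⊎ B ∋ (x ∷ [])) →
                  HasInterval (λ x → A ∋ (x ∷ [])) ⊎ HasInterval (λ x → B ∋ (x ∷ []))
  HasInterval-⊎ A B (a , b , a<b , h) with germ A a
  ... | e , a<e , inj₁ in-A  = inj₁ (a , e , a<e , in-A)
  ... | e , a<e , inj₂ not-A = let d , a<d , below = meet a<e a<b in
    inj₂ (a , d , a<d , λ x a<x x<d → let x<e , x<b = below x<d in
      [ (λ x∈A → contradiction x∈A (not-A x a<x x<e)) , id ]′ (h x a<x x<b))

  -- In the local description of A near a no piece can be a nonempty interval. Finitely many points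
  -- remain, and those other than a are avoided by shrinking the neighbourhood.
  isolate : (A : DefSet 1) → ¬ HasInterval (λ x → A ∋ (x ∷ [])) → ∀ a →
            ∃[ b ] ∃[ c ] ((b < a × a < c) × (∀ x → b < x → x < c → A ∋ (x ∷ []) → x ≡ a))
  isolate A ¬int a with local _ (definable₁ A) a
  ... | b , c , (b<a , a<c) , ps , h =
    let u , v , (u<a , a<v) , iso = pieces ps λ x x∈ps → proj₁ (from (h x) x∈ps)
        l , l<a , above = join b<a u<a
        r , a<r , below = meet a<c a<v
    in l , r , (l<a , a<r) , λ x l<x x<r x∈A →
      let b<x , u<x = above l<x ; x<c , x<v = below x<r in
      iso x u<x x<v (to (h x) (x∈A , b<x , x<c))
    where
    Isolated : List (Piece 𝓜) → Set ℓ
    Isolated ps = ∃[ b ] ∃[ c ] ((b < a × a < c) × (∀ x → b < x → x < c → Any (_∈ₚ_ 𝓜 x) ps → x ≡ a))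

    everywhere : ∀ {ps} → (∀ x → Any (_∈ₚ_ 𝓜 x) ps → x ≡ a) → Isolated ps
    everywhere f = let b , b<a = no-least a ; c , a<c = no-greatest a in
      b , c , (b<a , a<c) , λ x _ _ → f x

    piece : ∀ p → (∀ x → Any (_∈ₚ_ 𝓜 x) (p ∷ []) → A ∋ (x ∷ [])) → Isolated (p ∷ [])
    piece (point u) f with compare a u
    ... | tri< a<u _ _  = let b , b<a = no-least a in
      b , u , (b<a , a<u) , λ { _ _ x<x (here refl) → contradiction x<x <-irrefl }
    ... | tri≈ _ refl _ = everywhere λ { _ (here x≡a) → x≡a }
    ... | tri> _ _ u<a  = let c , a<c = no-greatest a in
      u , c , (u<a , a<c) , λ { _ x<x _ (here refl) → contradiction x<x <-irrefl }
    piece (interval u v) f = everywhere λ { x (here (u<x , x<v)) →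
      contradiction (u , v , <-trans u<x x<v , λ z u<z z<v → f z (here (u<z , z<v))) ¬int }

    pieces : ∀ ps → (∀ x → Any (_∈ₚ_ 𝓜 x) ps → A ∋ (x ∷ [])) → Isolated ps
    pieces []       f = everywhere λ _ ()
    pieces (p ∷ ps) f =
      let b , c , (b<a , a<c) , iso = piece p λ { x (here x∈p) → f x (here x∈p) }
          u , v , (u<a , a<v) , iso′ = pieces ps λ x x∈ps → f x (there x∈ps)
          l , l<a , above = join b<a u<a
          r , a<r , below = meet a<c a<v
      in l , r , (l<a , a<r) , λ where
        x l<x x<r (here x∈p)   → iso x (proj₁ (above l<x)) (proj₁ (below x<r)) (here x∈p)
        x l<x x<r (there x∈ps) → iso′ x (proj₂ (above l<x)) (proj₂ (below x<r)) x∈ps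

  -- Infima and least elements

  open AddExtrema (StrictToNonStrict._≤_ _≡_ _<_) using (_≤±_) renaming ([_] to lift≤)

  private
    ≤⇒≯ : ∀ {x y} → [ x ] ≤± [ y ] → ¬ y < x
    ≤⇒≯ (lift≤ (inj₁ x<y))  = <-asym x<y
    ≤⇒≯ (lift≤ (inj₂ refl)) = <-irrefl

    ≯⇒≤ : ∀ {x y} → ¬ y < x → [ x ] ≤± [ y ]
    ≯⇒≤ {x} {y} y≮x with compare x y
    ... | tri< x<y _ _ = lift≤ (inj₁ x<y)
    ... | tri≈ _ x≡y _ = lift≤ (inj₂ x≡y)
    ... | tri> _ _ y<x = contradiction y<x y≮x

  LowerBound : Pred M ℓ → M → Set ℓ
  LowerBound P l = ∀ x → P x → ¬ x < l

  -- A lower bound excludes the value -∞, an element of the set excludes +∞.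
  infimum : (A : DefSet 1) → let P = λ x → A ∋ (x ∷ []) in ∃ P → ∃ (LowerBound P) →
            ∃[ i ] (LowerBound P i × (∀ l → LowerBound P l → ¬ i < l))
  infimum A (x , x∈A) (l , l≤) with proj₂ (complete _ (definable₁ A))
  ... | ⊥± , _ , greatest with greatest [ l ] (λ z∈A → ≯⇒≤ (l≤ _ z∈A))
  ...   | AddSupremum.[ () ]
  infimum A (x , x∈A) (l , l≤) | ⊤± , lower , _ with lower x∈A
  ...   | ()
  infimum A (x , x∈A) (l , l≤) | [ i ] , lower , greatest =
    i , (λ z z∈A → ≤⇒≯ (lower z∈A)) , λ l l≤ → ≤⇒≯ (greatest [ l ] λ z∈A → ≯⇒≤ (l≤ _ z∈A))

  -- The infimum i of the part of A above a belongs to it. Otherwise the germ at i would either put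
  -- an interval into A or give a lower bound greater than i.
  least-above : (A : DefSet 1) → let P = λ x → A ∋ (x ∷ []) in ¬ HasInterval P →
                ∀ a x → a < x → P x →
                ∃[ z ] (a < z × P z × ¬ x < z × (∀ w → a < w → w < z → ¬ P w))
  least-above A ¬int a x a<x x∈A = result
    where
    A⁺ = (const a ≺ₐ x₀) ⋀ A
    inf = infimum A⁺ (x , a<x , x∈A) (a , λ z (a<z , _) → <-asym a<z)
    i = proj₁ inf

    i∈A⁺ : A⁺ ∋ (i ∷ [])
    i∈A⁺ with em {P = A⁺ ∋ (i ∷ [])} | germ A⁺ i
    ... | yes i∈ | _ = i∈
    ... | no _   | e , i<e , inj₁ in-A⁺  =
      contradiction (i , e , i<e , λ z i<z z<e → proj₂ (in-A⁺ z i<z z<e)) ¬int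
    ... | no i∉  | e , i<e , inj₂ not-A⁺ = contradiction i<e (proj₂ (proj₂ inf) e lower)
      where
      lower : ∀ z → A⁺ ∋ (z ∷ []) → ¬ z < e
      lower z z∈ z<e with compare i z
      ... | tri< i<z _ _  = not-A⁺ z i<z z<e z∈
      ... | tri≈ _ refl _ = i∉ z∈
      ... | tri> _ _ z<i  = proj₁ (proj₂ inf) z z∈ z<i

    result = i , proj₁ i∈A⁺ , proj₂ i∈A⁺ , proj₁ (proj₂ inf) x (a<x , x∈A) ,
      λ w a<w w<i w∈A → proj₁ (proj₂ inf) w (a<w , w∈A) w<i

  -- Families of subsets of the line

  -- Suppose that all fibers over points y are small. Each nonempty one has a first point above a,
  -- so `First` meets every (a , e) and by its germ contains some (a , e). Fix x there with (x , y)
  -- in Q. A slightly larger x′ is first in the fiber over some y′, so (x , y′) is not in Q, and the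
  -- exchange condition puts (x′ , y) into Q. Thus the fiber over y contains an interval after all.
  exists-large-fiber : (Q : DefSet 2) → ∀ a b → a < b →
    (∀ x → a < x → x < b → ∃[ y ] Q ∋ (x ∷ y ∷ [])) →
    (∀ x y → Q ∋ (x ∷ y ∷ []) → ∃[ e ] (x < e × (∀ x′ y′ → x < x′ → x′ < e →
      Q ∋ (x′ ∷ y′ ∷ []) → Q ∋ (x ∷ y′ ∷ []) ⊎ Q ∋ (x′ ∷ y ∷ [])))) →
    ∃[ y ] HasInterval (λ x → Q ∋ (x ∷ y ∷ []))
  exists-large-fiber Q a b a<b cover exchange =
    decidable-stable em λ none → absurd λ y int → none (y , int)
    where
    First : DefSet 1
    First = some (Q ⟨ x₁ ∷ x₀ ∷ [] ⟩ ⋀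
      every (const a ≺ₐ x₀ ⇒ x₀ ≺ₐ x₂ ⇒ complement (Q ⟨ x₀ ∷ x₁ ∷ [] ⟩)))

    absurd : ¬ (∀ y → ¬ HasInterval (λ x → Q ∋ (x ∷ y ∷ [])))
    absurd small with germ First a
    ... | e , a<e , inj₂ none =
      let d , a<d , below = meet a<e a<b
          x , a<x , x<d = dense a<d
          y , xy = cover x a<x (proj₂ (below x<d))
          z , a<z , zy , x≮z , first = least-above (Q ⟨ x₀ ∷ const y ∷ [] ⟩) (small y) a x a<x xy
      in none z a<z (≮-<-trans x≮z (proj₁ (below x<d))) (y , zy , first)
    ... | e , a<e , inj₁ firsts =
      let d , a<d , below = meet a<e a<b
          x , a<x , x<d = dense a<d
          y , xy = cover x a<x (proj₂ (below x<d))
          e′ , x<e′ , exch = exchange x y xy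
          c , x<c , below′ = meet x<d x<e′
      in small y (x , c , x<c , λ x′ x<x′ x′<c →
        let x′<d , x′<e′ = below′ x′<c
            y′ , x′y′ , first = firsts x′ (<-trans a<x x<x′) (proj₁ (below x′<d))
        in [ (λ xy′ → contradiction xy′ (first x a<x x<x′)) , id ]′ (exch x′ y′ x<x′ x′<e′ x′y′))

  -- The condition says that the sets of y over the points x form a chain under inclusion. This is
  -- how a bound depending on x is made constant on an interval of x.
  exists-large-fiber-chain : (Q : DefSet 2) →
    (∀ x x′ y y′ → Q ∋ (x ∷ y ∷ []) → Q ∋ (x′ ∷ y′ ∷ []) → Q ∋ (x ∷ y′ ∷ []) ⊎ Q ∋ (x′ ∷ y ∷ [])) →
    HasInterval (λ x → ∃[ y ] Q ∋ (x ∷ y ∷ [])) → ∃[ y ] HasInterval (λ x → Q ∋ (x ∷ y ∷ []))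
  exists-large-fiber-chain Q chain (a , b , a<b , cover) =
    exists-large-fiber Q a b a<b cover λ x y xy →
      let e , x<e = no-greatest x in e , x<e , λ x′ y′ _ _ x′y′ → chain x x′ y y′ xy x′y′

  Open₁-interval : ∀ a b → Open₁ 𝓜 (Interval 𝓜 a b)
  Open₁-interval a b x∈ = a , b , x∈ , id

  projection-large : (T : DefSet 2) → HasInterval (λ x → ∃[ y ] T ∋ (x ∷ y ∷ [])) →
    HasInterval (λ y → ∃[ x ] T ∋ (x ∷ y ∷ [])) ⊎ ∃[ y ] HasInterval (λ x → T ∋ (x ∷ y ∷ []))
  projection-large T (a , b , a<b , h)
    with em {P = HasInterval (λ y → ∃[ x ] T ∋ (x ∷ y ∷ []))}
       | em {P = ∃[ y ] HasInterval (λ x → T ∋ (x ∷ y ∷ []))}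
  ... | yes int | _       = inj₁ int
  ... | no _    | yes int = inj₂ int
  ... | no ¬int | no ¬fib = ⊥-elim impossible
    where
    -- Since y is isolated in the second projection, points of T in a thin strip have the same y,
    -- and x is isolated in the fiber over that y.
    discrete : Discrete 𝓜 (T ∋_)
    discrete {x ∷ y ∷ []} xy =
      let b , c , y∈ , iso = isolate (some T) ¬int y
          u , v , x∈ , iso′ = isolate (T ⟨ x₀ ∷ const y ∷ [] ⟩) (λ int → ¬fib (y , int)) x
          V = λ { zero → Interval 𝓜 u v ; (suc _) → Interval 𝓜 b c }
      in Product 𝓜 V
       , (λ z∈ → V , (λ { zero → Open₁-interval u v ; (suc zero) → Open₁-interval b c }) , z∈ , id)
       , (λ { zero → x∈ ; (suc zero) → y∈ })
       , λ { {x′ ∷ y′ ∷ []} x′y′ in-box → unique (iso y′) (iso′ x′) x′y′ (in-box zero) (in-box (suc zero)) }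
      where
      unique : ∀ {x′ y′ b c u v} →
               (b < y′ → y′ < c → (some T) ∋ (y′ ∷ []) → y′ ≡ y) →
               (u < x′ → x′ < v → T ∋ (x′ ∷ y ∷ []) → x′ ≡ x) →
               T ∋ (x′ ∷ y′ ∷ []) → Interval 𝓜 u v x′ → Interval 𝓜 b c y′ → x′ ∷ y′ ∷ [] ≡ x ∷ y ∷ []
      unique isoʸ isoˣ x′y′ (u<x′ , x′<v) (b<y′ , y′<c) with isoʸ b<y′ y′<c (_ , x′y′)
      ... | refl = cong (_∷ y ∷ []) (isoˣ u<x′ x′<v x′y′)

    π : CoordinateProjection 𝓜 2 1
    π = record { indices = zero ∷ [] ; increasing = [] ∷ [] }

    in-image : ∀ x → a < x → x < b → image 𝓜 π (T ∋_) (x ∷ [])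
    in-image x a<x x<b = let y , xy = h x a<x x<b in x ∷ y ∷ [] , xy , refl

    impossible : ⊥
    -- The first projection is discrete but contains (a , b): a point x′ just above x contradicts
    -- the isolation of x.
    impossible =
      let x , a<x , x<b = dense a<b
          y , xy = h x a<x x<b
          U , open-U , x∈U , only = propertyA π (T ∋_) (definable T) (_ , xy) discrete
                                      (in-image x a<x x<b)
          V , open-V , x∈V , V⊆U = open-U x∈U
          u , v , (u<x , x<v) , uv⊆V = open-V zero (x∈V zero)
          d , x<d , below = meet x<v x<b
          x′ , x<x′ , x′<d = dense x<d
          x′<v , x′<b = below x′<d
          x′≡x = only (in-image x′ (<-trans a<x x<x′) x′<b)
                      (V⊆U λ { zero → uv⊆V (<-trans u<x x<x′ , x′<v) })
      in <-irrefl (subst (x <_) (cong head x′≡x) x<x′)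

  -- From large vertical fibers to a large horizontal fiber

  module _ (S : DefSet 2) (l : M) (bounded : ∀ x y → S ∋ (x ∷ y ∷ []) → l < y)
           (a b : M) (a<b : a < b)
           (large-fibers : ∀ x → a < x → x < b → HasInterval (λ y → S ∋ (x ∷ y ∷ []))) where

    private
      -- (x , c) such that the fiber Sₓ contains some (c , e) but no (c′ , c].
      -- Unlike Sₓ itself, its set of left ends is not large, which excludes one of
      -- the two outcomes of projection-large in varying-leftEnd.
      LeftEnd : DefSet 2
      LeftEnd = (const a ≺ₐ x₀ ⋀ x₀ ≺ₐ const b)
        ⋀ some (x₂ ≺ₐ x₀ ⋀ every (x₃ ≺ₐ x₀ ⇒ x₀ ≺ₐ x₁ ⇒ S ⟨ x₂ ∷ x₀ ∷ [] ⟩))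
        ⋀ complement (some (x₀ ≺ₐ x₂ ⋀
            every (x₁ ≺ₐ x₀ ⇒ complement (x₃ ≺ₐ x₀) ⇒ S ⟨ x₂ ∷ x₀ ∷ [] ⟩)))

      -- In an interval of left ends, take c and a slightly larger c′ within the interval of the
      -- fiber that begins at c. Then (c , c′] lies in the fiber, so c′ is not a left end.
      leftEnd-small : ∀ x → ¬ HasInterval (λ c → LeftEnd ∋ (x ∷ c ∷ []))
      leftEnd-small x (u , v , u<v , ends) =
        let c , u<c , c<v = dense u<v
            _ , (e , c<e , inside) , _ = ends c u<c c<v
            d , c<d , below = meet c<e c<v
            c′ , c<c′ , c′<d = dense c<d
            c′<e , c′<v = below c′<d
            _ , _ , not-inner = ends c′ (<-trans u<c c<c′) c′<v
        in not-inner (c , c<c′ , λ z c<z c′≮z → inside z c<z (≮-<-trans c′≮z c′<e))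

      leftEnd-exists : ∀ x → a < x → x < b → ∃[ c ] LeftEnd ∋ (x ∷ c ∷ [])
      leftEnd-exists x a<x x<b with large-fibers x a<x x<b
      ... | c , d , c<d , inside = i , (a<x , x<b) , (d , i<d , right) , λ (c′ , c′<i , inner) →
        proj₁ (proj₂ inf) c′ (<-trans c′<i i<d , λ z c′<z z<d → extend inner z c′<z z<d) c′<i
        where
        -- The interval (c , d) is extended to the left as far as possible: i is the infimum of the
        -- points from which the fiber is filled up to d. It exists because the fiber lies above l.
        Start : DefSet 1
        Start = x₀ ≺ₐ const d ⋀ every (x₁ ≺ₐ x₀ ⇒ x₀ ≺ₐ const d ⇒ S ⟨ const x ∷ x₀ ∷ [] ⟩)

        start-bounded : LowerBound (λ z → Start ∋ (z ∷ [])) l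
        start-bounded z (z<d , in-S) z<l =
          let m , z<m , below = meet z<d z<l
              w , z<w , w<m = dense z<m
              w<d , w<l = below w<m
          in <-asym w<l (bounded x w (in-S w z<w w<d))

        inf = infimum Start (c , c<d , inside) (l , start-bounded)
        i = proj₁ inf

        i<d : i < d
        i<d = ≮-<-trans (proj₁ (proj₂ inf) c (c<d , inside)) c<d

        right : ∀ z → i < z → z < d → S ∋ (x ∷ z ∷ [])
        right z i<z z<d = decidable-stable em λ z∉S → proj₂ (proj₂ inf) z
          (λ w (w<d , in-S) w<z → z∉S (in-S z w<z z<d)) i<z

        extend : ∀ {c′} → (∀ z → c′ < z → ¬ i < z → S ∋ (x ∷ z ∷ [])) →
                 ∀ z → c′ < z → z < d → S ∋ (x ∷ z ∷ [])
        extend inner z c′<z z<d with em {P = i < z}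
        ... | yes i<z = right z i<z z<d
        ... | no i≮z  = inner z c′<z i≮z

      large-fiber-of-S : Set ℓ
      large-fiber-of-S = ∃[ y ] HasInterval (λ x → S ∋ (x ∷ y ∷ []))

      -- With c fixed, the sets of e such that (c , e] lies in the fiber over x are initial segments
      -- of the points above c, hence a chain. A common e lies itself in all these fibers.
      constant-leftEnd : ∀ c → HasInterval (λ x → LeftEnd ∋ (x ∷ c ∷ [])) → large-fiber-of-S
      constant-leftEnd c int =
        map₂ (HasInterval-map λ x (c<e , in-S) → in-S _ c<e <-irrefl)
          (exists-large-fiber-chain Reaches chain (HasInterval-map start int))
        where
        Reaches : DefSet 2
        Reaches = const c ≺ₐ x₁ ⋀ every (const c ≺ₐ x₀ ⇒ complement (x₂ ≺ₐ x₀) ⇒ S ⟨ x₁ ∷ x₀ ∷ [] ⟩)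

        chain : ∀ x x′ e e′ → Reaches ∋ (x ∷ e ∷ []) → Reaches ∋ (x′ ∷ e′ ∷ []) →
                Reaches ∋ (x ∷ e′ ∷ []) ⊎ Reaches ∋ (x′ ∷ e ∷ [])
        chain x x′ e e′ (c<e , in-S) (c<e′ , in-S′) with em {P = e′ < e}
        ... | yes e′<e = inj₁ (c<e′ , λ z c<z e′≮z → in-S z c<z (λ e<z → e′≮z (<-trans e′<e e<z)))
        ... | no e′≮e  = inj₂ (c<e , λ z c<z e≮z → in-S′ z c<z (λ e′<z → e≮z (≮-<-trans e′≮e e′<z)))

        start : ∀ x → LeftEnd ∋ (x ∷ c ∷ []) → ∃[ e ] Reaches ∋ (x ∷ e ∷ [])
        start x (_ , (e , c<e , in-S) , _) = let d , c<d , d<e = dense c<e in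
          d , c<d , λ z c<z d≮z → in-S z c<z (≮-<-trans d≮z d<e)

      module _ (u v : M) (u<v : u < v)
               (ends : ∀ c → u < c → c < v → ∃[ x ] LeftEnd ∋ (x ∷ c ∷ []))
               (small : ∀ c → ¬ HasInterval (λ x → LeftEnd ∋ (x ∷ c ∷ []))) where

        -- Choosing for every end c the first x of which it is a left end makes the
        -- intervals (c , p] in Sₓ depend on c alone; exists-large-fiber then finds
        -- a p that works for an interval of ends.
        FirstEnd : DefSet 2
        FirstEnd = LeftEnd ⋀ every (x₀ ≺ₐ x₁ ⇒ complement (LeftEnd ⟨ x₀ ∷ x₂ ∷ [] ⟩))

        -- All x with left end c lie above a by the definition of `LeftEnd`, so the first one above
        -- a is the first of all.
        firstEnd-exists : ∀ c → u < c → c < v → ∃[ x ] FirstEnd ∋ (x ∷ c ∷ [])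
        firstEnd-exists c u<c c<v =
          let x , end = ends c u<c c<v
              z , _ , end′ , _ , least =
                least-above (LeftEnd ⟨ x₀ ∷ const c ∷ [] ⟩) (small c) a x (proj₁ (proj₁ end)) end
          in z , end′ , λ w w<z end″ → least w (proj₁ (proj₁ end″)) w<z end″

        Reaches : DefSet 3
        Reaches = x₁ ≺ₐ x₂ ⋀ FirstEnd ⟨ x₀ ∷ x₁ ∷ [] ⟩
          ⋀ every (x₂ ≺ₐ x₀ ⇒ complement (x₃ ≺ₐ x₀) ⇒ S ⟨ x₁ ∷ x₀ ∷ [] ⟩)

        ReachesFromFirst : DefSet 2
        ReachesFromFirst = some Reaches

        cover : ∀ c → u < c → c < v → ∃[ p ] ReachesFromFirst ∋ (c ∷ p ∷ [])
        cover c u<c c<v =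
          let x , first = firstEnd-exists c u<c c<v
              (_ , (e , c<e , in-S) , _) , _ = first
              p , c<p , p<e = dense c<e
          in p , x , c<p , first , λ z c<z p≮z → in-S z c<z (≮-<-trans p≮z p<e)

        exchange : ∀ c p → ReachesFromFirst ∋ (c ∷ p ∷ []) → ∃[ e ] (c < e × (∀ c′ p′ → c < c′ → c′ < e →
          ReachesFromFirst ∋ (c′ ∷ p′ ∷ []) →
          ReachesFromFirst ∋ (c ∷ p′ ∷ []) ⊎ ReachesFromFirst ∋ (c′ ∷ p ∷ [])))
        -- The neighbourhood of c ends at p, so that p still lies to the right of c′. The smaller of
        -- p and p′ is then reached from both c and c′.
        exchange c p (x , c<p , first , in-S) = p , c<p , exch
          where
          exch : ∀ c′ p′ → c < c′ → c′ < p → ReachesFromFirst ∋ (c′ ∷ p′ ∷ []) →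
                 ReachesFromFirst ∋ (c ∷ p′ ∷ []) ⊎ ReachesFromFirst ∋ (c′ ∷ p ∷ [])
          exch c′ p′ c<c′ c′<p (x′ , c′<p′ , first′ , in-S′) with em {P = p′ < p}
          ... | yes p′<p = inj₁ (x , <-trans c<c′ c′<p′ , first ,
                  λ z c<z p′≮z → in-S z c<z (λ p<z → p′≮z (<-trans p′<p p<z)))
          ... | no p′≮p  = inj₂ (x′ , c′<p , first′ ,
                  λ z c′<z p≮z → in-S′ z c′<z (λ p′<z → p≮z (≮-<-trans p′≮p p′<z)))

        varying-leftEnd : large-fiber-of-S
        -- For a p reached from an interval of ends c, `projection-large` is applied to the pairs of
        -- c and its first x. Either these x contain an interval, over which p lies in the fibers of
        -- S, or a single x has an interval of left ends.
        varying-leftEnd =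
          case exists-large-fiber ReachesFromFirst u v u<v cover exchange of λ (p , int) →
          [ (λ int′ → p , HasInterval-map (λ x (c , reaches) → inside x c p reaches) int′)
          , (λ (x , int′) →
              contradiction (HasInterval-map (λ c → is-leftEnd x c p) int′) (leftEnd-small x))
          ]′ (projection-large (Reaches ⟨ x₁ ∷ x₀ ∷ const p ∷ [] ⟩) int)
          where
          inside : ∀ x c p → Reaches ∋ (x ∷ c ∷ p ∷ []) → S ∋ (x ∷ p ∷ [])
          inside x c p (c<p , _ , in-S) = in-S p c<p <-irrefl

          is-leftEnd : ∀ x c p → Reaches ∋ (x ∷ c ∷ p ∷ []) → LeftEnd ∋ (x ∷ c ∷ [])
          is-leftEnd x c p (_ , (end , _) , _) = end

    -- If no c is a left end for an interval of x, then `projection-large` shows that the left ends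
    -- themselves contain an interval.
    large-fiber-bounded-below : large-fiber-of-S
    large-fiber-bounded-below with em {P = ∃[ c ] HasInterval (λ x → LeftEnd ∋ (x ∷ c ∷ []))}
    ... | yes (c , int) = constant-leftEnd c int
    ... | no small      =
      [ (λ (u , v , u<v , ends) → varying-leftEnd u v u<v ends λ c int → small (c , int))
      , (λ large → contradiction large small)
      ]′ (projection-large LeftEnd (a , b , a<b , leftEnd-exists))

  -- Each fiber has an interval above its own bound, and the admissible bounds are closed downwards,
  -- so they form a chain as x varies. The common l supplies the bound from which infima in the
  -- fibers are taken.
  large-fibers-above : (S : DefSet 2) → HasInterval (λ x → HasInterval (λ y → S ∋ (x ∷ y ∷ []))) →
    ∃[ l ] HasInterval (λ x → HasInterval (λ y → l < y × S ∋ (x ∷ y ∷ [])))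
  large-fibers-above S = exists-large-fiber-chain (large (x₂ ≺ₐ x₀ ⋀ S ⟨ x₁ ∷ x₀ ∷ [] ⟩)) chain
    ∘ HasInterval-map λ x (c , d , c<d , h) → c , c , d , c<d , λ y c<y y<d → c<y , h y c<y y<d
    where
    chain : ∀ x x′ l l′ → HasInterval (λ y → l < y × S ∋ (x ∷ y ∷ [])) →
            HasInterval (λ y → l′ < y × S ∋ (x′ ∷ y ∷ [])) →
            HasInterval (λ y → l′ < y × S ∋ (x ∷ y ∷ [])) ⊎ HasInterval (λ y → l < y × S ∋ (x′ ∷ y ∷ []))
    chain x x′ l l′ h h′ = ≮-cases l l′
      (λ l′≮l → inj₂ (HasInterval-map (λ y (l′<y , xy) → ≮-<-trans l′≮l l′<y , xy) h′))
      (λ l≮l′ → inj₁ (HasInterval-map (λ y (l<y , xy) → ≮-<-trans l≮l′ l<y , xy) h))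

  large-fiber-swap : (S : DefSet 2) → HasInterval (λ x → HasInterval (λ y → S ∋ (x ∷ y ∷ []))) →
                     ∃[ y ] HasInterval (λ x → S ∋ (x ∷ y ∷ []))
  large-fiber-swap S int = case large-fibers-above S int of λ (l , a , b , a<b , fibers) →
    map₂ (HasInterval-map λ x → proj₂)
      (large-fiber-bounded-below (const l ≺ₐ x₁ ⋀ S) l (λ x y → proj₁) a b a<b fibers)

  -- Intervals uniform in a parameter

  Shrinkable : (M → M → Set ℓ) → Set ℓ
  Shrinkable P = ∀ {c c′ e e′} → ¬ c′ < c → ¬ e < e′ → P c e → P c′ e′

  -- First `large-fiber-swap` finds a point y inside the intervals (c , e) for an interval of x.
  -- Then c is fixed to the left of y and e to the right of y; by shrinking, the admissible ends
  -- form chains. The point y ensures c < e.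
  uniform-interval : (P : DefSet 3) → (∀ x → Shrinkable (λ c e → P ∋ (x ∷ c ∷ e ∷ []))) →
    HasInterval (λ x → ∃[ c ] ∃[ e ] (c < e × P ∋ (x ∷ c ∷ e ∷ []))) →
    ∃[ c ] ∃[ e ] (c < e × HasInterval (λ x → P ∋ (x ∷ c ∷ e ∷ [])))
  uniform-interval P shrink int =
    case large-fiber-swap
      (some (some (x₁ ≺ₐ x₃ ⋀ x₃ ≺ₐ x₀ ⋀ P ⟨ x₂ ∷ x₁ ∷ x₀ ∷ [] ⟩)))
      (HasInterval-map (λ x (c , e , c<e , p) → c , e , c<e , λ y c<y y<e → c , e , c<y , y<e , p) int)
    of λ (y , int₀) →
    case exists-large-fiber-chain
      (some (x₂ ≺ₐ const y ⋀ const y ≺ₐ x₀ ⋀ P ⟨ x₁ ∷ x₂ ∷ x₀ ∷ [] ⟩))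
      (λ x x′ c c′ (e , c<y , y<e , p) (e′ , c′<y , y<e′ , p′) → ≮-cases c c′
        (λ c′≮c → inj₁ (e , c′<y , y<e , shrink x c′≮c <-irrefl p))
        (λ c≮c′ → inj₂ (e′ , c<y , y<e′ , shrink x′ c≮c′ <-irrefl p′)))
      (HasInterval-map (λ x (c , e , c<y , y<e , p) → c , e , c<y , y<e , p) int₀)
    of λ (c , int₁) →
    case exists-large-fiber-chain
      (const y ≺ₐ x₁ ⋀ P ⟨ x₀ ∷ const c ∷ x₁ ∷ [] ⟩)
      (λ x x′ e e′ (y<e , p) (y<e′ , p′) → ≮-cases e e′
        (λ e′≮e → inj₂ (y<e , shrink x′ <-irrefl e′≮e p′))
        (λ e≮e′ → inj₁ (y<e′ , shrink x <-irrefl e≮e′ p)))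
      (HasInterval-map (λ x (e , c<y , y<e , p) → e , y<e , p) int₁)
    of λ (e , int₂) →
    let _ , _ , c<y , _ = HasInterval-nonempty int₁
        _ , y<e , _     = HasInterval-nonempty int₂
    in c , e , <-trans c<y y<e , HasInterval-map (λ x → proj₂) int₂

  -- The intervals in the fibers over y are replaced by a common (c , e), which gives a box, and a
  -- box can be read in either order.
  uniform-subinterval : (S : DefSet 2) → HasInterval (λ y → HasInterval (λ x → S ∋ (x ∷ y ∷ []))) →
                        HasInterval (λ x → HasInterval (λ y → S ∋ (x ∷ y ∷ [])))
  uniform-subinterval S int =
    case uniform-interval (every (x₂ ≺ₐ x₀ ⇒ x₀ ≺ₐ x₃ ⇒ S ⟨ x₀ ∷ x₁ ∷ [] ⟩))
      (λ y c′≮c e≮e′ h x c′<x x<e′ → h x (≮-<-trans c′≮c c′<x) (<-≮-trans x<e′ e≮e′)) int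
    of λ (c , e , c<e , h) → c , e , c<e , λ x c<x x<e → HasInterval-map (λ y f → f x c<x x<e) h

  -- Ranks

  Quantifier : Bool → Pred M ℓ → Set ℓ
  Quantifier true  = HasInterval
  Quantifier false = ∃

  quantify : ∀ {n} → Bool → DefSet (suc n) → DefSet n
  quantify b A = record { definable = def b }
    where
    def : ∀ b → Definable 𝓜 (λ ρ → Quantifier b (λ x → A ∋ (x ∷ ρ)))
    def true  = definable (large A)
    def false = definable (some A)

  Quantifier-map : ∀ b {P Q : Pred M ℓ} → (∀ x → P x → Q x) → Quantifier b P → Quantifier b Q
  Quantifier-map true  = HasInterval-map
  Quantifier-map false f (x , p) = x , f x p

  Quantifier-nonempty : ∀ b {P : Pred M ℓ} → Quantifier b P → ∃ P
  Quantifier-nonempty true  = HasInterval-nonempty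
  Quantifier-nonempty false = id

  Quantifier-⊎ : ∀ b (A B : DefSet 1) → Quantifier b (λ x → A ∋ (x ∷ []) ⊎ B ∋ (x ∷ [])) →
                 Quantifier b (λ x → A ∋ (x ∷ [])) ⊎ Quantifier b (λ x → B ∋ (x ∷ []))
  Quantifier-⊎ true  A B            = HasInterval-⊎ A B
  Quantifier-⊎ false A B (x , inj₁ a) = inj₁ (x , a)
  Quantifier-⊎ false A B (x , inj₂ b) = inj₂ (x , b)

  -- The first coordinate is quantified innermost, so that in Mᵐ⁺ⁿ the base is Mⁿ.
  Big : ∀ {n} → Vec Bool n → (Vec M n → Set ℓ) → Set ℓ
  Big []      P = P []
  Big (b ∷ s) P = Big s (λ ρ → Quantifier b (λ x → P (x ∷ ρ)))

  HasRank : ∀ {n} → (Vec M n → Set ℓ) → ℕ → Set ℓ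
  HasRank P d = ∃[ s ] (Big s P × ∣ s ∣ ≡ d)

  Big-map : ∀ {n} (s : Vec Bool n) {P Q : Vec M n → Set ℓ} → (∀ ρ → P ρ → Q ρ) → Big s P → Big s Q
  Big-map []      f = f []
  Big-map (b ∷ s) f = Big-map s λ ρ → Quantifier-map b λ x → f (x ∷ ρ)

  HasRank-map : ∀ {n d} {P Q : Vec M n → Set ℓ} → (∀ ρ → P ρ → Q ρ) → HasRank P d → HasRank Q d
  HasRank-map f (s , big , eq) = s , Big-map s f big , eq

  Big-nonempty : ∀ {n} (s : Vec Bool n) {P : Vec M n → Set ℓ} → Big s P → ∃ P
  Big-nonempty []      p = [] , p
  Big-nonempty (b ∷ s) big with Big-nonempty s big
  ... | ρ , q with Quantifier-nonempty b q
  ... | x , p = x ∷ ρ , p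

  Big-⊎ : ∀ {n} (s : Vec Bool n) (A B : DefSet n) →
          Big s (λ ρ → A ∋ ρ ⊎ B ∋ ρ) → Big s (A ∋_) ⊎ Big s (B ∋_)
  Big-⊎ []      A B p   = p
  Big-⊎ (b ∷ s) A B big = Big-⊎ s (quantify b A) (quantify b B)
    (Big-map s (λ ρ → Quantifier-⊎ b (slice {1} A ρ) (slice {1} B ρ)) big)

  Big-++⁻ : ∀ {m n} (s : Vec Bool m) (t : Vec Bool n) {P} →
            Big (s ++ t) P → Big t (λ ρ → Big s (λ σ → P (σ ++ ρ)))
  Big-++⁻ []      t big = big
  Big-++⁻ (b ∷ s) t big = Big-++⁻ s t big

  Big-++⁺ : ∀ {m n} (s : Vec Bool m) (t : Vec Bool n) {P} →
            Big t (λ ρ → Big s (λ σ → P (σ ++ ρ))) → Big (s ++ t) P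
  Big-++⁺ []      t big = big
  Big-++⁺ (b ∷ s) t big = Big-++⁺ s t big

  Big-replicate-false : ∀ {n} (ρ : Vec M n) {P} → P ρ → Big (replicate n false) P
  Big-replicate-false []      p = p
  Big-replicate-false (x ∷ ρ) p = Big-replicate-false ρ (x , p)

  ∣++∣ : ∀ {m n} (s : Vec Bool m) (t : Vec Bool n) → ∣ s ++ t ∣ ≡ ∣ s ∣ + ∣ t ∣
  ∣++∣ []          t = refl
  ∣++∣ (true ∷ s)  t = cong suc (∣++∣ s t)
  ∣++∣ (false ∷ s) t = ∣++∣ s t

  ∣∷∣-cong : ∀ {m n} b (s : Vec Bool m) (t : Vec Bool n) → ∣ s ∣ ≡ ∣ t ∣ → ∣ b ∷ s ∣ ≡ ∣ b ∷ t ∣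
  ∣∷∣-cong true  s t = cong suc
  ∣∷∣-cong false s t = id

  ∣∷∷∣-swap : ∀ {n} b c (s : Vec Bool n) → ∣ b ∷ c ∷ s ∣ ≡ ∣ c ∷ b ∷ s ∣
  ∣∷∷∣-swap true  true  s = refl
  ∣∷∷∣-swap true  false s = refl
  ∣∷∷∣-swap false true  s = refl
  ∣∷∷∣-swap false false s = refl

  HasInterval-subsingleton : ∀ {P : Pred M ℓ} → (∀ x y → P x → P y → x ≡ y) → ¬ HasInterval P
  HasInterval-subsingleton unique (a , b , a<b , h) =
    let x , a<x , x<b = dense a<b
        y , x<y , y<b = dense x<b
    in irrefl (unique x y (h x a<x x<b) (h y (<-trans a<x x<y) y<b)) x<y

  Big-subsingleton : ∀ {n} (s : Vec Bool n) {P} → (∀ ρ σ → P ρ → P σ → ρ ≡ σ) → Big s P → ∣ s ∣ ≡ 0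
  Big-subsingleton []          unique big = refl
  Big-subsingleton (true ∷ s)  unique big = let ρ , int = Big-nonempty s big in
    contradiction int (HasInterval-subsingleton λ x y p q → cong head (unique (x ∷ ρ) (y ∷ ρ) p q))
  Big-subsingleton (false ∷ s) unique big =
    Big-subsingleton s (λ ρ σ (_ , p) (_ , q) → cong tail (unique _ _ p q)) big

  -- Permutations of the coordinates

  swap-quantifiers : (S : DefSet 2) → ∀ b c →
    Quantifier c (λ y → Quantifier b (λ x → S ∋ (x ∷ y ∷ []))) →
    Quantifier b (λ x → Quantifier c (λ y → S ∋ (x ∷ y ∷ []))) ⊎
    Quantifier c (λ x → Quantifier b (λ y → S ∋ (x ∷ y ∷ [])))
  swap-quantifiers S true  true  int           = inj₁ (uniform-subinterval S int)
  swap-quantifiers S true  false (y , int)     = inj₁ (HasInterval-map (λ x p → y , p) int)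
  -- The only case with the second outcome: `projection-large` may give an interval of x instead of
  -- a single x. The variables are then exchanged while the quantifiers stay in place, which leaves
  -- the rank unchanged.
  swap-quantifiers S false true  int           = Sum.swap (projection-large (S ⟨ x₁ ∷ x₀ ∷ [] ⟩) int)
  swap-quantifiers S false false (y , x , p)   = inj₁ (x , y , p)

  -- Words in adjacent transpositions, because only neighbouring quantifiers can be exchanged. The
  -- two lengths are always equal as numbers; separate indices avoid transport between forms such as
  -- m + suc n and suc (m + n).
  data Perm : ℕ → ℕ → Set where
    idᵖ  : ∀ {n} → Perm n n
    lift : ∀ {m n} → Perm m n → Perm (suc m) (suc n)
    swap : ∀ {n} → Perm (suc (suc n)) (suc (suc n))
    _⨾_  : ∀ {l m n} → Perm l m → Perm m n → Perm l n

  act : ∀ {a} {A : Set a} {m n} → Perm m n → Vec A m → Vec A n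
  act idᵖ      v           = v
  act (lift π) (x ∷ v)     = x ∷ act π v
  act swap     (x ∷ y ∷ v) = y ∷ x ∷ v
  act (π ⨾ τ)  v           = act τ (act π v)

  map-act : ∀ {a b} {A : Set a} {B : Set b} {m n} (f : A → B) (π : Perm m n) (v : Vec A m) →
            map f (act π v) ≡ act π (map f v)
  map-act f idᵖ      v           = refl
  map-act f (lift π) (x ∷ v)     = cong (f x ∷_) (map-act f π v)
  map-act f swap     (x ∷ y ∷ v) = refl
  map-act f (π ⨾ τ)  v           = trans (map-act f τ (act π v)) (cong (act τ) (map-act f π v))

  permute : ∀ {m n} → Perm m n → DefSet n → DefSet m
  permute π A = pullback A (act π)
    (act π (map coord (allFin _)) , λ ρ → trans (map-act (value ρ) π _) (cong (act π) (value-coords ρ)))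

  HasRank-permute : ∀ {m n d} (π : Perm m n) (A : DefSet n) →
                    HasRank (A ∋_) d → HasRank (permute π A ∋_) d
  HasRank-permute idᵖ      A rank = rank
  HasRank-permute (π ⨾ τ)  A rank = HasRank-permute π (permute τ A) (HasRank-permute τ A rank)
  HasRank-permute (lift π) A (b ∷ s , big , eq) =
    let t , big′ , eq′ = HasRank-permute π (quantify b A) (s , big , refl)
    in b ∷ t , big′ , trans (∣∷∣-cong b t s eq′) eq
  HasRank-permute swap A (b ∷ c ∷ s , big , eq) =
    -- Which outcome of `swap-quantifiers` occurs may depend on the remaining coordinates; `Big-⊎`
    -- selects one that holds under s.
    [ (λ big′ → c ∷ b ∷ s , big′ , trans (∣∷∷∣-swap c b s) eq)
    , (λ big′ → b ∷ c ∷ s , big′ , eq)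
    ]′ (Big-⊎ s (quantify b (quantify c A′)) (quantify c (quantify b A′))
          (Big-map s (λ ρ → swap-quantifiers (slice {2} A ρ) b c) big))
    where A′ = permute swap A

  insertᵖ : ∀ m n → Perm (m + suc n) (suc (m + n))
  insertᵖ zero    n = idᵖ
  insertᵖ (suc m) n = lift (insertᵖ m n) ⨾ swap

  blocks : ∀ m n → Perm (m + n) (n + m)
  blocks zero    zero    = idᵖ
  blocks (suc m) zero    = lift (blocks m zero)
  blocks m       (suc n) = insertᵖ m n ⨾ lift (blocks m n)

  module _ {a} {A : Set a} where

    act-insert : ∀ {m n} (v : Vec A m) x (w : Vec A n) → act (insertᵖ m n) (v ++ x ∷ w) ≡ x ∷ v ++ w
    act-insert []      x w = refl
    act-insert (y ∷ v) x w = cong (act swap ∘ (y ∷_)) (act-insert v x w)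

    act-blocks : ∀ {m n} (v : Vec A m) (w : Vec A n) → act (blocks m n) (v ++ w) ≡ w ++ v
    act-blocks []      []      = refl
    act-blocks (x ∷ v) []      = cong (x ∷_) (act-blocks v [])
    act-blocks []      (y ∷ w) = cong (y ∷_) (act-blocks [] w)
    act-blocks (x ∷ v) (y ∷ w) = trans
      (cong (act (lift (blocks _ _))) (act-insert (x ∷ v) y w)) (cong (y ∷_) (act-blocks (x ∷ v) w))

  -- Ranks of a relation and of its projections

  module _ {m n : ℕ} (R : DefSet (m + n)) where

    -- With the block of y moved innermost, its quantifiers range over sets with at most one point.
    -- None of them is an interval quantifier, so the block of x carries the whole rank.
    HasRank-domain : ∀ {d} → (∀ x y z → R ∋ (x ++ y) → R ∋ (x ++ z) → y ≡ z) →
                     HasRank (R ∋_) d → HasRank (λ x → ∃[ y ] R ∋ (x ++ y)) d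
    HasRank-domain functional rank with HasRank-permute (blocks n m) R rank
    ... | s , big , eq with splitAt n s
    ... | s₁ , s₂ , refl = s₂ , Big-map s₂ (λ x → Big-nonempty s₁) big′ ,
      trans (sym (trans (∣++∣ s₁ s₂) (cong (_+ ∣ s₂ ∣) zero-rank))) eq
      where
      big′ : Big s₂ (λ x → Big s₁ (λ y → R ∋ (x ++ y)))
      big′ = Big-map s₂ (λ x → Big-map s₁ λ y → subst (R ∋_) (act-blocks y x)) (Big-++⁻ s₁ s₂ big)

      zero-rank : ∣ s₁ ∣ ≡ 0
      zero-rank = let x , fiber-big = Big-nonempty s₂ big′ in
        Big-subsingleton s₁ (functional x) fiber-big

    HasRank-codomain : ∀ {d} → HasRank (λ y → ∃[ x ] R ∋ (x ++ y)) d → HasRank (R ∋_) d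
    HasRank-codomain (t , big , eq) =
      replicate m false ++ t ,
      Big-++⁺ (replicate m false) t (Big-map t (λ y (x , r) → Big-replicate-false x r) big) ,
      trans (∣++∣ (replicate m false) t) (trans (cong (_+ ∣ t ∣) (∣⊥∣≡0 m)) eq)

  -- This is `HasRank-codomain` with the two blocks of coordinates exchanged.
  HasRank-total : ∀ {m n d} (R : DefSet (m + n)) →
                  HasRank (λ x → ∃[ y ] R ∋ (x ++ y)) d → HasRank (R ∋_) d
  HasRank-total {m} {n} R rank = HasRank-map back
    (HasRank-permute (blocks m n) R′
      (HasRank-codomain {n} {m} R′ (HasRank-map
        (λ x (y , r) → y , subst (R ∋_) (sym (act-blocks y x)) r) rank)))
    where
    R′ = permute (blocks n m) R
    back : ∀ z → R ∋ act (blocks n m) (act (blocks m n) z) → R ∋ z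
    back z r with splitAt m z
    ... | x , y , refl =
      subst (R ∋_) (trans (cong (act (blocks n m)) (act-blocks x y)) (act-blocks y x)) r

  -- Rank and dimension

  -- The choice of c and e is pulled out through one quantifier at a time, by `uniform-interval` for
  -- an interval quantifier and trivially for a point.
  uniform-interval-Big : ∀ {n} (s : Vec Bool n) (P : DefSet (suc (suc n))) →
    (∀ ρ → Shrinkable (λ c e → P ∋ (c ∷ e ∷ ρ))) →
    Big s (λ ρ → ∃[ c ] ∃[ e ] (c < e × P ∋ (c ∷ e ∷ ρ))) →
    ∃[ c ] ∃[ e ] (c < e × Big s (λ ρ → P ∋ (c ∷ e ∷ ρ)))
  uniform-interval-Big []      P shrink big = big
  uniform-interval-Big (b ∷ s) P shrink big =
    uniform-interval-Big s (quantify b P′)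
      (λ ρ c′≮c e≮e′ → Quantifier-map b λ x → shrink (x ∷ ρ) c′≮c e≮e′)
      (Big-map s (uniform b) big)
    where
    P′ = permute (swap ⨾ lift swap) P
    uniform : ∀ b ρ → Quantifier b (λ x → ∃[ c ] ∃[ e ] (c < e × P ∋ (c ∷ e ∷ x ∷ ρ))) →
              ∃[ c ] ∃[ e ] (c < e × Quantifier b (λ x → P ∋ (c ∷ e ∷ x ∷ ρ)))
    uniform true  ρ int                     = uniform-interval (slice {3} P′ ρ) (λ x → shrink (x ∷ ρ)) int
    uniform false ρ (x , c , e , c<e , p)   = c , e , c<e , x , p

  module _ {n d : ℕ} (π : CoordinateProjection 𝓜 n d) where
    open CoordinateProjection π

    private
      shifted : AllPairs Fin._<_ (map suc indices)
      shifted = AllPairs.map⁺ (AllPairs.map ℕ.s≤s increasing)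

    omit-head : CoordinateProjection 𝓜 (suc n) d
    omit-head = record { indices = map suc indices ; increasing = shifted }

    keep-head : CoordinateProjection 𝓜 (suc n) (suc d)
    keep-head = record
      { indices    = zero ∷ map suc indices
      ; increasing = All.map⁺ (All.universal (λ _ → ℕ.z<s) _) ∷ shifted
      }

    project-omit-head : ∀ x ρ → project 𝓜 omit-head (x ∷ ρ) ≡ project 𝓜 π ρ
    project-omit-head x ρ = sym (map-∘ (lookup (x ∷ ρ)) suc indices)

  -- The projection keeps the coordinates with an interval quantifier. For such a first coordinate,
  -- `uniform-interval-Big` makes the interval independent of the other coordinates, so the image
  -- contains a product of that interval with an open set.
  Big⇒projection : ∀ {n} (s : Vec Bool n) (A : DefSet n) → Big s (A ∋_) →
                   HasProjectionWithInterior 𝓜 (A ∋_) ∣ s ∣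
  Big⇒projection [] A p = zero-projection 𝓜 (A ∋_) ([] , p)
  Big⇒projection (false ∷ s) A big with Big⇒projection s (some A) big
  ... | π , y , U , open-U , y∈U , U⊆ = omit-head π , y , U , open-U , y∈U , λ z∈U →
    let ρ , (x , p) , eq = U⊆ z∈U in x ∷ ρ , p , trans (project-omit-head π x ρ) eq
  Big⇒projection {suc n} (true ∷ s) A big
    with uniform-interval-Big s Contains (λ ρ c′≮c e≮e′ h x c′<x x<e′ →
           h x (≮-<-trans c′≮c c′<x) (<-≮-trans x<e′ e≮e′)) big
    where
    Contains : DefSet (suc (suc n))
    Contains = every (x₁ ≺ₐ x₀ ⇒ x₀ ≺ₐ x₂ ⇒ insert₂ A)
  ... | c , e , c<e , big′
    with Big⇒projection s
           (every (const c ≺ₐ x₀ ⇒ x₀ ≺ₐ const e ⇒ A)) big′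
  ... | π , y , U , open-U , y∈U , U⊆ =
    let x , c<x , x<e = dense c<e in
    keep-head π , x ∷ y , (λ z → Interval 𝓜 c e (head z) × U (tail z)) ,
    (λ { {_ ∷ _} (x∈ , z∈U) → let V , open-V , z∈V , V⊆U = open-U z∈U in
         (λ { zero → Interval 𝓜 c e ; (suc i) → V i }) ,
         (λ { zero → Open₁-interval c e ; (suc i) → open-V i }) ,
         (λ { zero → x∈ ; (suc i) → z∈V i }) ,
         λ { {_ ∷ _} z∈ → z∈ zero , V⊆U (λ i → z∈ (suc i)) } }) ,
    ((c<x , x<e) , y∈U) ,
    λ { {w ∷ _} ((c<w , w<e) , z∈U) → let ρ , h , eq = U⊆ z∈U in
        w ∷ ρ , h w c<w w<e , cong (w ∷_) (trans (project-omit-head π w ρ) eq) }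

  HasRank⇒projection : ∀ {n d} (A : DefSet n) → HasRank (A ∋_) d →
                       HasProjectionWithInterior 𝓜 (A ∋_) d
  HasRank⇒projection A (s , big , refl) = Big⇒projection s A big

  Big-Product : ∀ {n} (V : Fin n → Pred M ℓ) (x : Vec M n) → (∀ i → Open₁ 𝓜 (V i)) →
                x ∈ Product 𝓜 V → Big (replicate n true) (Product 𝓜 V)
  -- Here `Big` unfolds to the empty product, and the last argument is an index in `Fin 0`.
  Big-Product V []      open-V x∈V ()
  Big-Product {suc n} V (x ∷ ρ) open-V x∈V =
    let a , b , (a<x , x<b) , ab⊆V = open-V zero (x∈V zero) in
    Big-map (replicate n true)
      (λ σ σ∈V → a , b , <-trans a<x x<b , λ z a<z z<b → λ
        { zero → ab⊆V (a<z , z<b) ; (suc i) → σ∈V i })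
      (Big-Product (V ∘ suc) ρ (open-V ∘ suc) (x∈V ∘ suc))

  equations : ∀ {n k} → Vec (Arg n) k → Vec (Arg n) k → DefSet n
  equations ts us = record { definable = def ts us }
    where
    def : ∀ {k} (ts us : Vec (Arg _) k) → Definable 𝓜 (λ ρ → map (value ρ) ts ≡ map (value ρ) us)
    def []       []       = definable-resp (λ ρ → mk⇔ (λ _ → refl) (λ _ _ → refl))
                                           (definable (every (x₀ ≐ₐ x₀)))
    def (t ∷ ts) (u ∷ us) = definable-resp
      (λ ρ → mk⇔ (λ (p , q) → cong₂ _∷_ p q) (λ eq → cong head eq , cong tail eq))
      (definable (t ≐ₐ u ⋀ record { definable = def ts us }))

  module _ {m n : ℕ} (x : Vec M m) (y : Vec M n) where

    value-left : ∀ {k} (is : Vec (Fin m) k) →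
                 map (value (x ++ y)) (map (λ i → coord (i ↑ˡ n)) is) ≡ map (lookup x) is
    value-left is = trans (sym (map-∘ (value (x ++ y)) _ is)) (map-cong (lookup-++ˡ x y) is)

    value-right : ∀ {k} (is : Vec (Fin n) k) →
                  map (value (x ++ y)) (map (λ i → coord (m ↑ʳ i)) is) ≡ map (lookup y) is
    value-right is = trans (sym (map-∘ (value (x ++ y)) _ is)) (map-cong (lookup-++ʳ x y) is)

  module _ {n d : ℕ} (A : DefSet n) (π : CoordinateProjection 𝓜 n d) where
    open CoordinateProjection π

    projection-graph : DefSet (n + d)
    projection-graph = A ⟨ map (λ i → coord (i ↑ˡ d)) (allFin n) ⟩
      ⋀ equations (map (λ i → coord (i ↑ˡ d)) indices) (map (λ j → coord (n ↑ʳ j)) (allFin d))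

    projection-graph⇔ : ∀ x y → projection-graph ∋ (x ++ y) ⇔ (A ∋ x × project 𝓜 π x ≡ y)
    projection-graph⇔ x y = mk⇔
      (λ (p , eq) → subst (A ∋_) left p , trans (sym (value-left x y indices)) (trans eq right))
      (λ (p , eq) → subst (A ∋_) (sym left) p , trans (value-left x y indices) (trans eq (sym right)))
      where
      left  = trans (value-left x y (allFin n)) (map-lookup-allFin x)
      right = trans (value-right x y (allFin d)) (map-lookup-allFin y)

  -- The image contains an open box, which has rank d. The rank passes to the graph of the
  -- projection restricted to A by `HasRank-codomain`, and on to A by `HasRank-domain` because the
  -- projection is a function.
  projection⇒HasRank : ∀ {n d} (A : DefSet n) → HasProjectionWithInterior 𝓜 (A ∋_) d →
                       HasRank (A ∋_) d
  projection⇒HasRank {d = d} A (π , y , U , open-U , y∈U , U⊆) =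
    let V , open-V , y∈V , V⊆U = open-U y∈U in
    HasRank-map (λ x (z , r) → proj₁ (to (projection-graph⇔ A π x z) r))
      (HasRank-domain (projection-graph A π)
        (λ x z z′ r r′ → trans (sym (proj₂ (to (projection-graph⇔ A π x z) r)))
                               (proj₂ (to (projection-graph⇔ A π x z′) r′)))
        (HasRank-codomain (projection-graph A π)
          ( replicate d true
          , Big-map (replicate d true)
              (λ z z∈V → map₂ (λ {x} → from (projection-graph⇔ A π x z)) (U⊆ (V⊆U z∈V)))
              (Big-Product V y open-V y∈V)
          , ∣⊤∣≡n d)))

  -- Additivity of ranks over fibers

  bigFibers : ∀ {m n} → Vec Bool m → DefSet (m + n) → DefSet n
  bigFibers s A = record { definable = def s A }
    where
    def : ∀ {m n} (s : Vec Bool m) (A : DefSet (m + n)) →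
          Definable 𝓜 (λ ρ → Big s (λ σ → A ∋ (σ ++ ρ)))
    def []      A = definable A
    def (b ∷ s) A = def s (quantify b A)

  ⋃ : ∀ {n} m → (Vec Bool m → DefSet n) → DefSet n
  ⋃ zero    A = A []
  ⋃ (suc m) A = ⋃ m (A ∘ (true ∷_)) ⋁ ⋃ m (A ∘ (false ∷_))

  ∈-⋃ : ∀ {m n} (A : Vec Bool m → DefSet n) s {ρ} → A s ∋ ρ → ⋃ m A ∋ ρ
  ∈-⋃ A []          p = p
  ∈-⋃ A (true ∷ s)  p = inj₁ (∈-⋃ (A ∘ (true ∷_)) s p)
  ∈-⋃ A (false ∷ s) p = inj₂ (∈-⋃ (A ∘ (false ∷_)) s p)

  Big-⋃ : ∀ {m n} (t : Vec Bool n) (A : Vec Bool m → DefSet n) → Big t (⋃ m A ∋_) →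
          ∃[ s ] Big t (A s ∋_)
  Big-⋃ {zero}  t A big = [] , big
  Big-⋃ {suc m} t A big with Big-⊎ t (⋃ m (A ∘ (true ∷_))) (⋃ m (A ∘ (false ∷_))) big
  ... | inj₁ big′ = let s , big″ = Big-⋃ t (A ∘ (true ∷_)) big′ in true ∷ s , big″
  ... | inj₂ big′ = let s , big″ = Big-⋃ t (A ∘ (false ∷_)) big′ in false ∷ s , big″

  module _ {m n : ℕ} (R : DefSet (m + n)) where

    -- The string that witnesses rank k may vary with the fiber, but there are only finitely many
    -- strings. By `Big-⋃` one of them, s, serves a set of y that is still big for t; the guard
    -- records that s has rank k.
    HasRank-fibers⁺ : ∀ {k d} {P : Vec M n → Set ℓ} → (∀ y → P y → HasRank (λ x → R ∋ (x ++ y)) k) →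
                      HasRank P d → HasRank (R ∋_) (d + k)
    HasRank-fibers⁺ {k} {d} fibers (t , big , refl) =
      let A = λ s → guard (∣ s ∣ ≡ k) (bigFibers s R)
          s , big′ = Big-⋃ t A (Big-map t (λ y p → let s , big , eq = fibers y p in ∈-⋃ A s (eq , big)) big)
          _ , ∣s∣≡k , _ = Big-nonempty t big′
      in s ++ t , Big-++⁺ s t (Big-map t (λ _ → proj₂) big′) ,
         trans (∣++∣ s t) (trans (cong (_+ ∣ t ∣) ∣s∣≡k) (ℕ.+-comm k ∣ t ∣))

    HasRank-fibers⁻ : ∀ {e} → HasRank (R ∋_) e → ∃[ d ] ∃[ k ]
      (e ≡ d + k × HasRank (λ y → ∃[ x ] R ∋ (x ++ y)) d × ∃[ y ] HasRank (λ x → R ∋ (x ++ y)) k)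
    HasRank-fibers⁻ (s , big , refl) with splitAt m s
    ... | s₁ , s₂ , refl =
      let big′ = Big-++⁻ s₁ s₂ big
          y , fiber-big = Big-nonempty s₂ big′
      in ∣ s₂ ∣ , ∣ s₁ ∣ , trans (∣++∣ s₁ s₂) (ℕ.+-comm ∣ s₁ ∣ ∣ s₂ ∣) ,
         (s₂ , Big-map s₂ (λ _ → Big-nonempty s₁) big′ , refl) , y , s₁ , fiber-big , refl

  -- Dimensions of the domain, the codomain and the fibers of a map

  module _ {m n : ℕ} {X : Subset 𝓜 m} {Y : Subset 𝓜 n} (dX : Definable 𝓜 X) (dY : Definable 𝓜 Y)
           (φ : DefinableMap 𝓜 X Y) (surjective : Surjective 𝓜 φ) where
    open DefinableMap φ using (graph; domain; codomain; functional)

    private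
      X′ : DefSet m
      X′ = record { definable = dX }

      Y′ : DefSet n
      Y′ = record { definable = dY }

      Γ : DefSet (m + n)
      Γ = record { definable = DefinableMap.definable φ }

      Γ⇔ : ∀ x y → Γ ∋ (x ++ y) ⇔ graph x y
      Γ⇔ x y = mk⇔ (subst₂ graph (take-++ x y) (drop-++ x y))
                   (subst₂ graph (sym (take-++ x y)) (sym (drop-++ x y)))
        where
        take-++ : ∀ {k} (v : Vec M k) {l} (w : Vec M l) → take k (v ++ w) ≡ v
        take-++ []      w = refl
        take-++ (a ∷ v) w = cong (a ∷_) (take-++ v w)

        drop-++ : ∀ {k} (v : Vec M k) {l} (w : Vec M l) → drop k (v ++ w) ≡ w
        drop-++ []      w = refl
        drop-++ (a ∷ v) w = drop-++ v w

      fiberSet : Vec M n → DefSet m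
      fiberSet y = record
        { definable = definable-resp (λ x → Γ⇔ x y) (definable (slice {m} Γ y)) }

      Γ-functional : ∀ x y z → Γ ∋ (x ++ y) → Γ ∋ (x ++ z) → y ≡ z
      Γ-functional x y z r r′ =
        let _ , _ , unique = functional (domain (to (Γ⇔ x y) r))
        in trans (sym (unique (to (Γ⇔ x y) r))) (unique (to (Γ⇔ x z) r′))

    -- Both bounds go through the graph, which has the ranks of X because the map is a function.
    -- Ranks of Y and of the fibers add up to a rank of the graph, and each rank of the graph splits
    -- into a rank of Y and a rank of one fiber.
    dim-additive : ∀ {b k} → IsDim 𝓜 Y (fin b) → (∀ {y} → y ∈ Y → IsDim 𝓜 (fiber 𝓜 φ y) (fin k)) →
                   IsDim 𝓜 X (fin (b + k))
    dim-additive {b} {k} ((y , y∈Y) , proj-Y , max-Y) dim-fiber =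
      map₂ domain (surjective y∈Y) , HasRank⇒projection X′ lower , upper
      where
      lower : HasRank X (b + k)
      lower = HasRank-map (λ x (y , r) → domain (to (Γ⇔ x y) r))
        (HasRank-domain {m} {n} Γ Γ-functional (HasRank-fibers⁺ {m} {n} Γ
          (λ y y∈Y → HasRank-map (λ x → from (Γ⇔ x y))
            (projection⇒HasRank (fiberSet y) (proj₁ (proj₂ (dim-fiber y∈Y)))))
          (projection⇒HasRank Y′ proj-Y)))

      upper : ∀ e → HasProjectionWithInterior 𝓜 X e → e ℕ.≤ b + k
      upper e proj-X
        with HasRank-fibers⁻ {m} {n} Γ (HasRank-total {m} {n} Γ (HasRank-map
               (λ x x∈X → let y , r , _ = functional x∈X in y , from (Γ⇔ x y) r)
               (projection⇒HasRank X′ proj-X)))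
      ... | d , j , refl , rank-Y , y , rank-fiber = ℕ.+-mono-≤
        (max-Y d (HasRank⇒projection Y′
          (HasRank-map (λ y (x , r) → codomain (to (Γ⇔ x y) r)) rank-Y)))
        (proj₂ (proj₂ (dim-fiber y∈Y′)) j (HasRank⇒projection (fiberSet y) rank-fiber′))
        where
        rank-fiber′ : HasRank (fiber 𝓜 φ y) j
        rank-fiber′ = HasRank-map (λ x → to (Γ⇔ x y)) rank-fiber

        -- The fiber over y has a rank, so it is nonempty and y is a value of the map.
        y∈Y′ : y ∈ Y
        y∈Y′ = codomain (proj₂ (Big-nonempty (proj₁ rank-fiber′) (proj₁ (proj₂ rank-fiber′))))

theorem3p14 : (em : ∀ {a} → ExcludedMiddle a) →
    ∀ {ℓ : Level} {L : Signature ℓ} (𝓜 : Structure L) →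
    DefinablyComplete 𝓜 → LocallyOMinimal 𝓜 → PropertyA 𝓜 →
    ∀ {m n : ℕ} (X : Subset 𝓜 m) (Y : Subset 𝓜 n) →
    Definable 𝓜 X → Definable 𝓜 Y →
    (φ : DefinableMap 𝓜 X Y) → Surjective 𝓜 φ →
    (∀ {y y′} → y ∈ Y → y′ ∈ Y → dim 𝓜 em (fiber 𝓜 φ y) ≡ dim 𝓜 em (fiber 𝓜 φ y′)) →
    ∀ {y} → y ∈ Y → dim 𝓜 em X ≡ dim 𝓜 em Y +₋ dim 𝓜 em (fiber 𝓜 φ y)
theorem3p14 em 𝓜 complete local propertyA X Y dX dY φ surjective equidimensional {y} y∈Y
  with dim 𝓜 em Y | dim-isDim 𝓜 em Y
     | dim 𝓜 em (fiber 𝓜 φ y) | dim-isDim 𝓜 em (fiber 𝓜 φ y)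
     -- Abstracted together with the dimension of the fiber over y, so that afterwards it equates
     -- the dimension of every fiber with `fin k`.
     | (λ {y′} (y′∈Y : y′ ∈ Y) → equidimensional y′∈Y y∈Y)
... | ⊥₋    | lift Y-empty | _     | _          | _ = contradiction y∈Y (Y-empty y)
... | fin _ | _            | ⊥₋    | lift empty | _ =
  let x , xy = surjective y∈Y in contradiction xy (empty x)
... | fin b | dim-Y        | fin k | _          | dims = IsDim-unique 𝓜 X (dim-isDim 𝓜 em X)
  (dim-additive dX dY φ surjective dim-Y λ {y′} y′∈Y →
    subst (IsDim 𝓜 (fiber 𝓜 φ y′)) (dims y′∈Y) (dim-isDim 𝓜 em (fiber 𝓜 φ y′)))
  where open Structures em 𝓜 complete local propertyA
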